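{- Let $P$ be a process, $(\mathcal A,\mathcal C,\vdash)$ a soft constraint system with a (possibly empty) set of non-logical axioms $\Delta$, $\Psi$ a set of process definitions, and $c\in\mathcal C$ a constraint. Then $P\Downarrow_c$ if and only if the sequent $$\Delta,\ [\![\Psi]\!],\ \mathcal P[\![P]\!]\ \longrightarrow\ c\otimes\top$$ is provable in $\mathrm{SELL}_\Sigma$, where each non-logical axiom of $\Delta$ occurs in the sequent in its encoded form $!^{\top_{\mathcal A}}(\forall\vec x.(d\multimap e))$ and $[\![\Psi]\!]$ is the set of encodings of the process definitions in $\Psi$.
   Context: **C-semiring.** A tuple $\langle \mathcal A,+_{\mathcal A},\times_{\mathcal A},\bot_{\mathcal A},\top_{\mathcal A}\rangle$ where $+_{\mathcal A}$ is a commutative, associative, idempotent binary operation on the set $\mathcal A$ with unit $\bot_{\mathcal A}$ and absorbing element $\top_{\mathcal A}$; $\times_{\mathcal A}$ is an associative, commutative binary operation on $\mathcal A$ with unit $\top_{\mathcal A}$ and absorbing element $\bot_{\mathcal A}$, and it distributes over $+_{\mathcal A}$. The order is $a\leq_{\mathcal A} b$ iff $a+_{\mathcal A}b=b$, and $\langle\mathcal A,\leq_{\mathcal A}\rangle$ is a complete lattice with bottom $\bot_{\mathcal A}$, top $\top_{\mathcal A}$ and least upper bound operation $+_{\mathcal A}$; $+_{\mathcal A}$ and $\times_{\mathcal A}$ are monotone and $a\times_{\mathcal A}b\leq_{\mathcal A}a$. **SELL.** A subexponential signature is $\Sigma=\langle I,\preceq,U\rangle$ with $I$ a set of labels, $\preceq$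 a pre-order on $I$, and $U\subseteq I$ upwardly closed under $\preceq$. The system $\mathrm{SELL}_\Sigma$ is the intuitionistic two-sided sequent calculus (left side a multiset of formulas, right side one formula) with the initial rule ($A\longrightarrow A$), the usual intuitionistic linear logic left/right rules for $\otimes,\mathbf 1,\multimap,\&,\exists,\forall$, the right rule $\Gamma\longrightarrow\top$, and, in place of the exponential $!$, a connective $!^a$ for each $a\in I$ with rules: - dereliction: from $\Gamma,F\longrightarrow G$ infer $\Gamma,!^aF\longrightarrow G$; - promotion: from $!^{a_1}F_1,\dots,!^{a_n}F_n\longrightarrow F$ infer $!^{a_1}F_1,\dots,!^{a_n}F_n\longrightarrow {!^a}F$, provided $a\preceq a_i$ for all $1\le i\le n$; - for $b\in U$, weakening (from $\Gamma\longrightarrow G$ infer $\Gamma,!^bF\longrightarrow G$) and contraction (from $\Gamma,!^bF,!^bF\longrightarrow G$ infer $\Gamma,!^bF\longrightarrow G$). **Soft constraint system.** Let $\langle \mathcal A,+_{\mathcal A},\times_{\mathcal A},\bot_{\mathcal A},\top_{\mathcal A}\rangle$ be a c-semiring, $\mathcal P$ a first-order signature, and $\Sigma_0=\langle\mathcal A,\leq_{\mathcal A},\mathcal A\rangle$ a subexponential signature. Constraints (elements of $\mathcal C$) are formulas built by the grammar $$C::=\mathbf 1\mid C\otimes C\mid \exists x.(C)\mid {!^a}A\mid {!^a}({!^a}A_1\otimes\cdots\otimes {!^a}A_n),$$ where $a\in\mathcal A$ and $A,A_i$ are atomic formulas over $\mathcal P$. Let $\Delta=\{\delta_1,\dots,\delta_n\}$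 be a possibly empty set of non-logical axioms, each of the form $\forall\vec x_i.(c_i\multimap d_i)$, with $c_i,d_i$ constraints and all free variables of $c_i$ and of $d_i$ among $\vec x_i$ (so the axioms are closed formulas). The soft constraint system is $\langle\mathcal A,\mathcal C,\vdash\rangle$, where $d\vdash c$ iff $!^{\top_{\mathcal A}}\delta_1,\dots,!^{\top_{\mathcal A}}\delta_n,d\longrightarrow c$ is provable in $\mathrm{SELL}_{\Sigma_0}$. As operations on stores, conjunction $\sqcup$ is $\otimes$, the empty store $\mathtt{true}$ is $\mathbf 1$, hiding is $\exists$, and $c\equiv d$ means $c\vdash d$ and $d\vdash c$. **Processes.** $P,Q::=\mathbf{tell}(c)\mid \sum_{i\in I}\mathbf{ask}\ c_i\ \mathbf{then}\ P_i\mid P\parallel Q\mid(\mathbf{local}\,x)\,P\mid p(\vec x)$, with $c,c_i\in\mathcal C$ and $I$ a non-empty finite index set; $(\mathbf{local}\,x)\,P$ binds $x$ in $P$, and $fv$ denotes free variables. A process definition is $p(\vec y)\stackrel{\Delta}{=}P$ with the variables $\vec y$ pairwise distinct and all free variables of $P$ in $\vec y$; each process name has a unique definition in $\Psi$. Process names $p$ are used as predicate symbols in the encoding below, distinct from those in $\mathcal P$. **Operational semantics.** A configuration $(X;\Gamma;d)$ consists of a set $X$ of hidden variables, a multiset $\Gamma=P_1,\dots,P_n$ of processes (identified with $P_1\parallel\cdots\parallel P_n$), and a constraint $d$ (the store). Structural congruence on processes is generated by alpha conversion of local variables, and commutativity and associativity of $\parallel$; $(X;\Gamma;c)\equiv(X';\Gamma';c')$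 iff $X=X'$, $\Gamma$ and $\Gamma'$ are congruent, and $c\equiv c'$. The transition relation $\longrightarrow$ on configurations is given by: - $(X;\mathbf{tell}(c),\Gamma;d)\longrightarrow(X;\Gamma;c\sqcup d)$; - $(X;\sum_{i\in I}\mathbf{ask}\ c_i\ \mathbf{then}\ P_i,\Gamma;d)\longrightarrow(X;P_j,\Gamma;d)$ if $j\in I$ and $d\vdash c_j$; - $(X;(\mathbf{local}\,x)\,P,\Gamma;d)\longrightarrow(X\cup\{x\};P,\Gamma;d)$ if $x\notin X\cup fv(d)\cup fv(\Gamma)$; - $(X;p(\vec y),\Gamma;d)\longrightarrow(X;P[\vec y/\vec x],\Gamma;d)$ if $p(\vec x)\stackrel{\Delta}{=}P$ is in $\Psi$; - closure of transitions under $\equiv$ on both sides. With $\longrightarrow^*$ the reflexive-transitive closure, $P\Downarrow_c$ means: $(\emptyset;P;\mathtt{true})\longrightarrow^*(X';\Gamma';d')$ for some $X',\Gamma',d'$ with $\exists X'.d'\vdash c$. **Signature $\Sigma$ for the encoding.** Add to $\mathcal A$ new labels $\mathfrak p,\mathfrak d,\mathfrak u$ and $\bot_c,\top_c$. The order extends $\leq_{\mathcal A}$, with $\mathfrak p,\mathfrak d,\mathfrak u$ pairwise unrelated and unrelated to every element of $\mathcal A$, with $\bot_c$ below all labels and $\top_c$ above all labels. The labels in $\mathcal A\cup\{\mathfrak u,\top_c\}$ are in $U$, while $\mathfrak p,\mathfrak d\notin U$ (hence also $\bot_c\notin U$). **Encoding.** - $\mathcal P[\![\mathbf{tell}(c)]\!]={!^{\mathfrak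 p}}c$; - $\mathcal P[\![\sum_{i\in I}\mathbf{ask}\ c_i\ \mathbf{then}\ P_i]\!]={!^{\mathfrak p}}\,\&_{i\in I}(c_i\multimap\mathcal P[\![P_i]\!])$; - $\mathcal P[\![(\mathbf{local}\,\vec x)\,P]\!]={!^{\mathfrak p}}(\exists\vec x.\mathcal P[\![P]\!])$; - $\mathcal P[\![P_1,\dots,P_n]\!]=\mathcal P[\![P_1]\!]\otimes\cdots\otimes\mathcal P[\![P_n]\!]$; - $\mathcal P[\![p(\vec x)]\!]={!^{\mathfrak d}}p(\vec x)$. A process definition $p(\vec x)\stackrel{\Delta}{=}P$ is encoded as $!^{\mathfrak u}[\forall\vec x.({!^{\mathfrak d}}p(\vec x)\multimap\mathcal P[\![P]\!])]$. -}

module Defs where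

open import Algebra.Definitions using (Idempotent; Zero)
open import Algebra.Structures using (IsCommutativeSemiring)
open import Data.Bool.Base using (if_then_else_)
open import Data.Fin.Base using (Fin; zero; suc)
open import Data.List.Base as List using (List; []; _∷_; [_]; _++_; concatMap; allFin)
open import Data.List.Membership.Propositional using (_∈_; _∉_)
open import Data.List.NonEmpty.Base as List⁺ using (List⁺; _∷_; toList)
open import Data.List.Relation.Binary.BagAndSetEquality using (_∼[_]_; set)
open import Data.List.Relation.Binary.Permutation.Propositional using (_↭_)
open import Data.List.Relation.Binary.Pointwise.Base using (Pointwise)
open import Data.List.Relation.Unary.All using (All)
open import Data.Nat.Base using (ℕ; zero; suc)
open import Data.Nat.Properties using (_≟_)
open import Data.Product.Base using (_×_; _,_; ∃; ∃-syntax; Σ-syntax)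
open import Data.Sum.Base using (_⊎_; inj₁; inj₂; [_,_]′)
open import Data.Unit.Polymorphic.Base using (⊤)
open import Data.Vec.Base as Vec using (Vec; []; _∷_)
open import Function.Base using (id; _∘_)
open import Level using (Level; 0ℓ; _⊔_) renaming (suc to lsuc)
open import Relation.Binary.Construct.Closure.ReflexiveTransitive using (Star)
open import Relation.Binary.Core using (Rel)
open import Relation.Binary.PropositionalEquality
  using (_≡_; refl; sym; trans; cong; isEquivalence)
open import Relation.Binary.Structures using (IsPreorder)
open import Relation.Nullary.Decidable.Core using (does)
open import Relation.Unary using (Pred)

private
  variable
    a b s t : Level
    m n : ℕ

------------------------------------------------------------------------
-- C-semirings

-- The remaining properties usually listed for c-semirings follow from these
-- fields: ≤ is a partial order with bottom ⊥ and top ⊤ and binary lub _+_,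
-- both operations are monotone, and x * y ≤ x.  Infima are suprema of sets of
-- lower bounds, so suprema of all subsets make ≤ a complete lattice.
record CSemiring (a : Level) : Set (lsuc a) where
  infixl 6 _+_
  infixl 7 _*_
  infix  4 _≤_
  field
    Carrier               : Set a
    _+_ _*_               : Carrier → Carrier → Carrier
    ⊥A ⊤A                 : Carrier
    isCommutativeSemiring : IsCommutativeSemiring _≡_ _+_ _*_ ⊥A ⊤A
    +-idem                : Idempotent _≡_ _+_
    +-zero                : Zero _≡_ ⊤A _+_

  _≤_ : Rel Carrier a
  x ≤ y = x + y ≡ y

  IsSupremum : Pred Carrier a → Carrier → Set a
  IsSupremum S u = (∀ x → S x → x ≤ u) × (∀ v → (∀ x → S x → x ≤ v) → u ≤ v)

  field
    complete : (S : Pred Carrier a) → ∃ (IsSupremum S)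

  open IsCommutativeSemiring isCommutativeSemiring public using (+-assoc)

  ≤-reflexive : ∀ {x y} → x ≡ y → x ≤ y
  ≤-reflexive refl = +-idem _

  ≤-trans : ∀ {x y z} → x ≤ y → y ≤ z → x ≤ z
  ≤-trans {x} {y} {z} p q =
    trans (cong (x +_) (sym q)) (trans (sym (+-assoc x y z)) (trans (cong (_+ z) p) q))

  ≤-isPreorder : IsPreorder _≡_ _≤_
  ≤-isPreorder = record
    { isEquivalence = isEquivalence
    ; reflexive     = ≤-reflexive
    ; trans         = ≤-trans
    }

------------------------------------------------------------------------
-- First-order syntax

record Symbols (s : Level) : Set (lsuc s) where
  field
    Symbol : Set s
    arity  : Symbol → ℕ

open Symbols public

record Signature (s : Level) : Set (lsuc s) where
  field
    functions  : Symbols s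
    predicates : Symbols s

open Signature public

-- Syntax with binders is locally nameless: bound variables are de Bruijn
-- indices and free variables are names, so α-equivalent expressions are
-- identical.  The closed-under-binders objects of the theory (formulas of a
-- sequent, stores, running processes) are those with n = 0; they may still
-- contain free names.
Name : Set
Name = ℕ

data Var (n : ℕ) : Set where
  bound : Fin n → Var n
  free  : Name → Var n

data Term (F : Symbols s) (n : ℕ) : Set s where
  var : Var n → Term F n
  fun : (f : Symbol F) → Vec (Term F n) (arity F f) → Term F n

infix 10 _·_
data Atom (S : Signature s) (n : ℕ) : Set s where
  _·_ : (p : Symbol (predicates S)) →
        Vec (Term (functions S) n) (arity (predicates S) p) → Atom S n

infixr 8 _⊗_
infixr 7 _&_
infixr 6 _⊸_
infix  9 ![_]_ ![_]⨂_

data Formula (L : Set a) (S : Signature s) : ℕ → Set (a ⊔ s) where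
  atom  : Atom S n → Formula L S n
  𝟏 ⊤ᶠ  : Formula L S n
  _⊗_   : Formula L S n → Formula L S n → Formula L S n
  _⊸_   : Formula L S n → Formula L S n → Formula L S n
  _&_   : Formula L S n → Formula L S n → Formula L S n
  ∃ᶠ ∀ᶠ : Formula L S (suc n) → Formula L S n
  ![_]_ : L → Formula L S n → Formula L S n

-- ![ l ]⨂ As stands for !ˡ(!ˡA₁ ⊗ ⋯ ⊗ !ˡAₙ).
data Constraint (A : Set a) (S : Signature s) : ℕ → Set (a ⊔ s) where
  𝟏      : Constraint A S n
  _⊗_    : Constraint A S n → Constraint A S n → Constraint A S n
  ∃ᶜ     : Constraint A S (suc n) → Constraint A S n
  ![_]_  : A → Atom S n → Constraint A S n
  ![_]⨂_ : A → List⁺ (Atom S n) → Constraint A S n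

-- Σ_{i ∈ I} ask cᵢ then Pᵢ is given by the non-empty list of its (cᵢ , Pᵢ).
infixr 6 _∥_
data Process (A : Set a) (S : Signature s) (N : Symbols 0ℓ) : ℕ → Set (a ⊔ s) where
  tell  : Constraint A S n → Process A S N n
  asks  : List⁺ (Constraint A S n × Process A S N n) → Process A S N n
  _∥_   : Process A S N n → Process A S N n → Process A S N n
  local : Process A S N (suc n) → Process A S N n
  call  : (p : Symbol N) → Vec (Var n) (arity N p) → Process A S N n

------------------------------------------------------------------------
-- Renaming and substitution (of both bound and free variables)

Renaming : ℕ → ℕ → Set
Renaming m n = Var m → Var n

Subst : Symbols s → ℕ → ℕ → Set s
Subst F m n = Var m → Term F n

shift : Renaming n (suc n)
shift (bound i) = bound (suc i)
shift (free x)  = free x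

liftʳ : Renaming m n → Renaming (suc m) (suc n)
liftʳ ρ (bound zero)    = bound zero
liftʳ ρ (bound (suc i)) = shift (ρ (bound i))
liftʳ ρ (free x)        = shift (ρ (free x))

module _ {F : Symbols s} where

  mutual
    subᵗ : Subst F m n → Term F m → Term F n
    subᵗ σ (var v)    = σ v
    subᵗ σ (fun f ts) = fun f (subᵗˢ σ ts)

    subᵗˢ : ∀ {k} → Subst F m n → Vec (Term F m) k → Vec (Term F n) k
    subᵗˢ σ []       = []
    subᵗˢ σ (t ∷ ts) = subᵗ σ t ∷ subᵗˢ σ ts

  liftˢ : Subst F m n → Subst F (suc m) (suc n)
  liftˢ σ (bound zero)    = var (bound zero)
  liftˢ σ (bound (suc i)) = subᵗ (var ∘ shift) (σ (bound i))
  liftˢ σ (free x)        = subᵗ (var ∘ shift) (σ (free x))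

  instantiate : Term F n → Subst F (suc n) n
  instantiate t (bound zero)    = t
  instantiate t (bound (suc i)) = var (bound i)
  instantiate t (free x)        = var (free x)

  abstractName : Name → Subst F n (suc n)
  abstractName x (bound i) = var (bound (suc i))
  abstractName x (free y)  = if does (x ≟ y) then var (bound zero) else var (free y)

openWith : Name → Renaming (suc n) n
openWith x (bound zero)    = free x
openWith x (bound (suc i)) = bound i
openWith x (free y)        = free y

parameters : Vec (Var n) m → Renaming m n
parameters ys (bound i) = Vec.lookup ys i
parameters ys (free x)  = free x

module _ {S : Signature s} where

  subᵃ : Subst (functions S) m n → Atom S m → Atom S n
  subᵃ σ (p · ts) = p · subᵗˢ σ ts

  subᶠ : {L : Set a} → Subst (functions S) m n → Formula L S m → Formula L S n
  subᶠ σ (atom A)     = atom (subᵃ σ A)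
  subᶠ σ 𝟏            = 𝟏
  subᶠ σ ⊤ᶠ           = ⊤ᶠ
  subᶠ σ (F ⊗ G)      = subᶠ σ F ⊗ subᶠ σ G
  subᶠ σ (F ⊸ G)      = subᶠ σ F ⊸ subᶠ σ G
  subᶠ σ (F & G)      = subᶠ σ F & subᶠ σ G
  subᶠ σ (∃ᶠ F)       = ∃ᶠ (subᶠ (liftˢ σ) F)
  subᶠ σ (∀ᶠ F)       = ∀ᶠ (subᶠ (liftˢ σ) F)
  subᶠ σ (![ l ] F)   = ![ l ] subᶠ σ F

  subᶜ : {A : Set a} → Subst (functions S) m n → Constraint A S m → Constraint A S n
  subᶜ σ 𝟏            = 𝟏
  subᶜ σ (c ⊗ d)      = subᶜ σ c ⊗ subᶜ σ d
  subᶜ σ (∃ᶜ c)       = ∃ᶜ (subᶜ (liftˢ σ) c)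
  subᶜ σ (![ l ] A)   = ![ l ] subᵃ σ A
  subᶜ σ (![ l ]⨂ As) = ![ l ]⨂ List⁺.map (subᵃ σ) As

module _ {A : Set a} {S : Signature s} {N : Symbols 0ℓ} where

  mutual
    renᴾ : Renaming m n → Process A S N m → Process A S N n
    renᴾ ρ (tell c)              = tell (subᶜ (var ∘ ρ) c)
    renᴾ ρ (asks ((c , P) ∷ bs)) = asks ((subᶜ (var ∘ ρ) c , renᴾ ρ P) ∷ renᴮ ρ bs)
    renᴾ ρ (P ∥ Q)               = renᴾ ρ P ∥ renᴾ ρ Q
    renᴾ ρ (local P)             = local (renᴾ (liftʳ ρ) P)
    renᴾ ρ (call p ys)           = call p (Vec.map ρ ys)

    renᴮ : Renaming m n → List (Constraint A S m × Process A S N m) →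
           List (Constraint A S n × Process A S N n)
    renᴮ ρ []             = []
    renᴮ ρ ((c , P) ∷ bs) = (subᶜ (var ∘ ρ) c , renᴾ ρ P) ∷ renᴮ ρ bs

------------------------------------------------------------------------
-- Free variables

fvᵛ : Var n → List Name
fvᵛ (bound i) = []
fvᵛ (free x)  = [ x ]

module _ {F : Symbols s} where

  mutual
    fvᵗ : Term F n → List Name
    fvᵗ (var v)    = fvᵛ v
    fvᵗ (fun f ts) = fvᵗˢ ts

    fvᵗˢ : ∀ {k} → Vec (Term F n) k → List Name
    fvᵗˢ []       = []
    fvᵗˢ (t ∷ ts) = fvᵗ t ++ fvᵗˢ ts

module _ {S : Signature s} where

  fvᵃ : Atom S n → List Name
  fvᵃ (p · ts) = fvᵗˢ ts

  fvᶠ : {L : Set a} → Formula L S n → List Name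
  fvᶠ (atom A)     = fvᵃ A
  fvᶠ 𝟏            = []
  fvᶠ ⊤ᶠ           = []
  fvᶠ (F ⊗ G)      = fvᶠ F ++ fvᶠ G
  fvᶠ (F ⊸ G)      = fvᶠ F ++ fvᶠ G
  fvᶠ (F & G)      = fvᶠ F ++ fvᶠ G
  fvᶠ (∃ᶠ F)       = fvᶠ F
  fvᶠ (∀ᶠ F)       = fvᶠ F
  fvᶠ (![ l ] F)   = fvᶠ F

  fvᶜ : {A : Set a} → Constraint A S n → List Name
  fvᶜ 𝟏            = []
  fvᶜ (c ⊗ d)      = fvᶜ c ++ fvᶜ d
  fvᶜ (∃ᶜ c)       = fvᶜ c
  fvᶜ (![ l ] A)   = fvᵃ A
  fvᶜ (![ l ]⨂ As) = concatMap fvᵃ (toList As)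

module _ {A : Set a} {S : Signature s} {N : Symbols 0ℓ} where

  mutual
    fvᴾ : Process A S N n → List Name
    fvᴾ (tell c)              = fvᶜ c
    fvᴾ (asks ((c , P) ∷ bs)) = fvᶜ c ++ fvᴾ P ++ fvᴮ bs
    fvᴾ (P ∥ Q)               = fvᴾ P ++ fvᴾ Q
    fvᴾ (local P)             = fvᴾ P
    fvᴾ (call p ys)           = concatMap fvᵛ (Vec.toList ys)

    fvᴮ : List (Constraint A S n × Process A S N n) → List Name
    fvᴮ []             = []
    fvᴮ ((c , P) ∷ bs) = fvᶜ c ++ fvᴾ P ++ fvᴮ bs

------------------------------------------------------------------------
-- SELL

record SubexpSignature (a : Level) : Set (lsuc a) where
  infix 4 _≼_
  field
    Label            : Set a
    _≼_              : Rel Label a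
    isPreorder       : IsPreorder _≡_ _≼_
    Unbounded        : Pred Label a
    unbounded-upward : ∀ {l k} → l ≼ k → Unbounded l → Unbounded k

open SubexpSignature public using (Label)

-- Left-hand sides are multisets: lists, with the rule exch for permutations.
infix 2 _∣_⟶_
data _∣_⟶_ (Σ : SubexpSignature a) {S : Signature s} :
     List (Formula (Label Σ) S 0) → Formula (Label Σ) S 0 → Set (a ⊔ s) where

  exch : ∀ {Γ Γ′ G} → Γ ↭ Γ′ → Σ ∣ Γ ⟶ G → Σ ∣ Γ′ ⟶ G
  init : ∀ {F} → Σ ∣ [ F ] ⟶ F

  𝟏R   : Σ ∣ [] ⟶ 𝟏
  𝟏L   : ∀ {Γ G} → Σ ∣ Γ ⟶ G → Σ ∣ 𝟏 ∷ Γ ⟶ G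
  ⊤R   : ∀ {Γ} → Σ ∣ Γ ⟶ ⊤ᶠ

  ⊗R   : ∀ {Γ Γ′ F G} → Σ ∣ Γ ⟶ F → Σ ∣ Γ′ ⟶ G → Σ ∣ Γ ++ Γ′ ⟶ F ⊗ G
  ⊗L   : ∀ {Γ F G H} → Σ ∣ F ∷ G ∷ Γ ⟶ H → Σ ∣ F ⊗ G ∷ Γ ⟶ H

  ⊸R   : ∀ {Γ F G} → Σ ∣ F ∷ Γ ⟶ G → Σ ∣ Γ ⟶ F ⊸ G
  ⊸L   : ∀ {Γ Γ′ F G H} → Σ ∣ Γ ⟶ F → Σ ∣ G ∷ Γ′ ⟶ H → Σ ∣ (F ⊸ G) ∷ Γ ++ Γ′ ⟶ H

  &R   : ∀ {Γ F G} → Σ ∣ Γ ⟶ F → Σ ∣ Γ ⟶ G → Σ ∣ Γ ⟶ F & G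
  &L₁  : ∀ {Γ F G H} → Σ ∣ F ∷ Γ ⟶ H → Σ ∣ F & G ∷ Γ ⟶ H
  &L₂  : ∀ {Γ F G H} → Σ ∣ G ∷ Γ ⟶ H → Σ ∣ F & G ∷ Γ ⟶ H

  ∃R   : ∀ {Γ F} t → Σ ∣ Γ ⟶ subᶠ (instantiate t) F → Σ ∣ Γ ⟶ ∃ᶠ F
  ∃L   : ∀ {Γ F G} x → x ∉ concatMap fvᶠ (∃ᶠ F ∷ G ∷ Γ) →
         Σ ∣ subᶠ (instantiate (var (free x))) F ∷ Γ ⟶ G → Σ ∣ ∃ᶠ F ∷ Γ ⟶ G

  ∀R   : ∀ {Γ F} x → x ∉ concatMap fvᶠ (∀ᶠ F ∷ Γ) →
         Σ ∣ Γ ⟶ subᶠ (instantiate (var (free x))) F → Σ ∣ Γ ⟶ ∀ᶠ F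
  ∀L   : ∀ {Γ F G} t → Σ ∣ subᶠ (instantiate t) F ∷ Γ ⟶ G → Σ ∣ ∀ᶠ F ∷ Γ ⟶ G

  dereliction : ∀ {Γ l F G} → Σ ∣ F ∷ Γ ⟶ G → Σ ∣ ![ l ] F ∷ Γ ⟶ G
  promotion   : ∀ {Γ l F} →
                All (λ H → ∃[ k ] ∃[ F′ ] H ≡ ![ k ] F′ × SubexpSignature._≼_ Σ l k) Γ →
                Σ ∣ Γ ⟶ F → Σ ∣ Γ ⟶ ![ l ] F
  weakening   : ∀ {Γ l F G} → SubexpSignature.Unbounded Σ l →
                Σ ∣ Γ ⟶ G → Σ ∣ ![ l ] F ∷ Γ ⟶ G
  contraction : ∀ {Γ l F G} → SubexpSignature.Unbounded Σ l →
                Σ ∣ ![ l ] F ∷ ![ l ] F ∷ Γ ⟶ G → Σ ∣ ![ l ] F ∷ Γ ⟶ G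

------------------------------------------------------------------------
-- Constraints and axioms as formulas

∀⋆ : {L : Set a} {S : Signature s} → Formula L S n → Formula L S 0
∀⋆ {n = zero}  F = F
∀⋆ {n = suc n} F = ∀⋆ (∀ᶠ F)

-- c ⊸ d, universally closed over its `arity` bound variables.
record Axiom (A : Set a) (S : Signature s) : Set (a ⊔ s) where
  field
    arity      : ℕ
    antecedent : Constraint A S arity
    consequent : Constraint A S arity
    closedᵃ    : fvᶜ antecedent ≡ []
    closedᶜ    : fvᶜ consequent ≡ []

-- Constraints are formulas over the labels 𝒜 and the signature 𝒫; the same
-- formulas are also read over larger sets of labels and predicates.
module Embedding {A : Set a} {L : Set b} {S : Signature s} {S′ : Signature t}
                 (label : A → L) (atomᴱ : ∀ {n} → Atom S n → Atom S′ n) where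

  formula : Constraint A S n → Formula L S′ n
  formula 𝟏            = 𝟏
  formula (c ⊗ d)      = formula c ⊗ formula d
  formula (∃ᶜ c)       = ∃ᶠ (formula c)
  formula (![ l ] A)   = ![ label l ] atom (atomᴱ A)
  formula (![ l ]⨂ As) =
    ![ label l ] List⁺.foldr₁ _⊗_ (List⁺.map (λ A → ![ label l ] atom (atomᴱ A)) As)

  axiomFormula : Axiom A S → Formula L S′ 0
  axiomFormula δ = ∀⋆ (formula (Axiom.antecedent δ) ⊸ formula (Axiom.consequent δ))

------------------------------------------------------------------------
-- Soft constraint systems

record SoftConstraintSystem (a s : Level) : Set (lsuc (a ⊔ s)) where
  field
    semiring  : CSemiring a
    signature : Signature s

  open CSemiring semiring public

  field
    axioms : List (Axiom Carrier signature)

  Con : ℕ → Set (a ⊔ s)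
  Con = Constraint Carrier signature

  Σ₀ : SubexpSignature a
  Σ₀ = record
    { Label            = Carrier
    ; _≼_              = _≤_
    ; isPreorder       = ≤-isPreorder
    ; Unbounded        = λ _ → ⊤
    ; unbounded-upward = λ _ u → u
    }

  open Embedding {S = signature} {S′ = signature} (id {A = Carrier}) id

  infix 4 _⊢_ _≃_
  _⊢_ : Con 0 → Con 0 → Set (a ⊔ s)
  d ⊢ c = Σ₀ ∣ List.map (λ δ → ![ ⊤A ] axiomFormula δ) axioms ++ [ formula d ] ⟶ formula c

  _≃_ : Con 0 → Con 0 → Set (a ⊔ s)
  c ≃ d = (c ⊢ d) × (d ⊢ c)

  hide : List Name → Con 0 → Con 0
  hide X d = List.foldr (λ x c → ∃ᶜ (subᶜ (abstractName x) c)) d X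

------------------------------------------------------------------------
-- Process definitions

-- The finitely many process names are the elements of Fin size; body p is the
-- body of the unique definition of p, its formal parameters being the bound
-- variables 0, …, arityᴺ p - 1.
record Definitions (A : Set a) (S : Signature s) : Set (a ⊔ s) where
  field
    size   : ℕ
    arityᴺ : Fin size → ℕ

  names : Symbols 0ℓ
  names = record { Symbol = Fin size ; arity = arityᴺ }

  field
    body   : (p : Fin size) → Process A S names (arityᴺ p)
    closed : ∀ p → fvᴾ (body p) ≡ []

------------------------------------------------------------------------
-- Operational semantics

module _ {A : Set a} {S : Signature s} {N : Symbols 0ℓ} where

  infix 4 _≅_ _≋_

  data _≅_ : Process A S N n → Process A S N n → Set (a ⊔ s) where
    ≅-refl     : {P : Process A S N n} → P ≅ P
    ≅-sym      : {P Q : Process A S N n} → P ≅ Q → Q ≅ P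
    ≅-trans    : {P Q R : Process A S N n} → P ≅ Q → Q ≅ R → P ≅ R
    ∥-comm     : {P Q : Process A S N n} → P ∥ Q ≅ Q ∥ P
    ∥-assoc    : {P Q R : Process A S N n} → (P ∥ Q) ∥ R ≅ P ∥ (Q ∥ R)
    ∥-cong     : {P P′ Q Q′ : Process A S N n} → P ≅ P′ → Q ≅ Q′ → P ∥ Q ≅ P′ ∥ Q′
    local-cong : {P P′ : Process A S N (suc n)} → P ≅ P′ → local P ≅ local P′
    asks-cong  : {bs bs′ : List⁺ (Constraint A S n × Process A S N n)} →
                 Pointwise (λ (c , P) (c′ , P′) → c ≡ c′ × P ≅ P′) (toList bs) (toList bs′) →
                 asks bs ≅ asks bs′

  -- Congruence of multisets P₁, …, Pₙ, each identified with P₁ ∥ ⋯ ∥ Pₙ.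
  data _≋_ : List (Process A S N 0) → List (Process A S N 0) → Set (a ⊔ s) where
    ≋-sym   : ∀ {Γ Γ′} → Γ ≋ Γ′ → Γ′ ≋ Γ
    ≋-trans : ∀ {Γ Γ′ Γ″} → Γ ≋ Γ′ → Γ′ ≋ Γ″ → Γ ≋ Γ″
    ≋-perm  : ∀ {Γ Γ′} → Γ ↭ Γ′ → Γ ≋ Γ′
    ≋-proc  : ∀ {Γ P P′} → P ≅ P′ → P ∷ Γ ≋ P′ ∷ Γ
    ≋-par   : ∀ {Γ P Q} → P ∥ Q ∷ Γ ≋ P ∷ Q ∷ Γ

module Semantics (𝒞 : SoftConstraintSystem a s)
                 (Ψ : Definitions (SoftConstraintSystem.Carrier 𝒞)
                                  (SoftConstraintSystem.signature 𝒞)) where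

  open SoftConstraintSystem 𝒞
  open Definitions Ψ

  Proc : ℕ → Set (a ⊔ s)
  Proc = Process Carrier signature names

  -- Finite sets of hidden variables are lists, compared as sets in ≋ᶜ.
  record Config : Set (a ⊔ s) where
    constructor ⟨_⨾_⨾_⟩
    field
      hidden    : List Name
      processes : List (Proc 0)
      store     : Con 0

  infix 4 _≋ᶜ_ _⟿_ _⟿*_ _⇓_

  _≋ᶜ_ : Config → Config → Set (a ⊔ s)
  ⟨ X ⨾ Γ ⨾ c ⟩ ≋ᶜ ⟨ X′ ⨾ Γ′ ⨾ c′ ⟩ = (X ∼[ set ] X′) × (Γ ≋ Γ′) × (c ≃ c′)

  -- In step-local, x ∉ fv(local P) is the condition under which α-conversion
  -- can choose x as the name of the binder.
  data _⟿_ : Config → Config → Set (a ⊔ s) where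
    step-tell   : ∀ {X Γ c d} → ⟨ X ⨾ tell c ∷ Γ ⨾ d ⟩ ⟿ ⟨ X ⨾ Γ ⨾ c ⊗ d ⟩
    step-ask    : ∀ {X Γ bs c P d} → (c , P) ∈ toList bs → d ⊢ c →
                  ⟨ X ⨾ asks bs ∷ Γ ⨾ d ⟩ ⟿ ⟨ X ⨾ P ∷ Γ ⨾ d ⟩
    step-local  : ∀ {X Γ P d} x → x ∉ X ++ fvᶜ d ++ concatMap fvᴾ (local P ∷ Γ) →
                  ⟨ X ⨾ local P ∷ Γ ⨾ d ⟩ ⟿ ⟨ x ∷ X ⨾ renᴾ (openWith x) P ∷ Γ ⨾ d ⟩
    step-call   : ∀ {X Γ p ys d} →
                  ⟨ X ⨾ call p ys ∷ Γ ⨾ d ⟩ ⟿ ⟨ X ⨾ renᴾ (parameters ys) (body p) ∷ Γ ⨾ d ⟩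
    step-struct : ∀ {C C′ D D′} → C ≋ᶜ C′ → C′ ⟿ D′ → D′ ≋ᶜ D → C ⟿ D

  _⟿*_ : Config → Config → Set (a ⊔ s)
  _⟿*_ = Star _⟿_

  _⇓_ : Proc 0 → Con 0 → Set (a ⊔ s)
  P ⇓ c = ∃[ X ] ∃[ Γ ] Σ[ d ∈ Con 0 ]
            (⟨ [] ⨾ [ P ] ⨾ 𝟏 ⟩ ⟿* ⟨ X ⨾ Γ ⨾ d ⟩) × (hide X d ⊢ c)

------------------------------------------------------------------------
-- The subexponential signature of the encoding

data ExtLabel (A : Set a) : Set a where
  ‵_       : A → ExtLabel A
  𝔭 𝔡 𝔲    : ExtLabel A
  ⊥ᶜ ⊤ᶜ    : ExtLabel A

module ExtSignature (𝒜 : CSemiring a) where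

  open CSemiring 𝒜

  infix 4 _⊑_

  data _⊑_ : Rel (ExtLabel Carrier) a where
    ‵⊑‵   : ∀ {x y} → x ≤ y → ‵ x ⊑ ‵ y
    𝔭⊑𝔭   : 𝔭 ⊑ 𝔭
    𝔡⊑𝔡   : 𝔡 ⊑ 𝔡
    𝔲⊑𝔲   : 𝔲 ⊑ 𝔲
    ⊥ᶜ⊑   : ∀ {l} → ⊥ᶜ ⊑ l
    ⊑⊤ᶜ   : ∀ {l} → l ⊑ ⊤ᶜ

  data Unb : Pred (ExtLabel Carrier) a where
    unb-‵  : ∀ {x} → Unb (‵ x)
    unb-𝔲  : Unb 𝔲
    unb-⊤ᶜ : Unb ⊤ᶜ

  ⊑-reflexive : ∀ {l k} → l ≡ k → l ⊑ k
  ⊑-reflexive {‵ x} refl = ‵⊑‵ (≤-reflexive refl)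
  ⊑-reflexive {𝔭}   refl = 𝔭⊑𝔭
  ⊑-reflexive {𝔡}   refl = 𝔡⊑𝔡
  ⊑-reflexive {𝔲}   refl = 𝔲⊑𝔲
  ⊑-reflexive {⊥ᶜ}  refl = ⊥ᶜ⊑
  ⊑-reflexive {⊤ᶜ}  refl = ⊑⊤ᶜ

  ⊑-trans : ∀ {l k j} → l ⊑ k → k ⊑ j → l ⊑ j
  ⊑-trans (‵⊑‵ p) (‵⊑‵ q) = ‵⊑‵ (≤-trans p q)
  ⊑-trans 𝔭⊑𝔭     q       = q
  ⊑-trans 𝔡⊑𝔡     q       = q
  ⊑-trans 𝔲⊑𝔲     q       = q
  ⊑-trans ⊥ᶜ⊑     q       = ⊥ᶜ⊑
  ⊑-trans p       ⊑⊤ᶜ     = ⊑⊤ᶜ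

  Unb-upward : ∀ {l k} → l ⊑ k → Unb l → Unb k
  Unb-upward (‵⊑‵ p) u = unb-‵
  Unb-upward 𝔲⊑𝔲     u = unb-𝔲
  Unb-upward ⊑⊤ᶜ     u = unb-⊤ᶜ

  Σᴱ : SubexpSignature a
  Σᴱ = record
    { Label            = ExtLabel Carrier
    ; _≼_              = _⊑_
    ; isPreorder       = record
      { isEquivalence = isEquivalence
      ; reflexive     = ⊑-reflexive
      ; trans         = ⊑-trans
      }
    ; Unbounded        = Unb
    ; unbounded-upward = Unb-upward
    }

------------------------------------------------------------------------
-- The encoding of processes

module Encoding (𝒞 : SoftConstraintSystem a s)
                (Ψ : Definitions (SoftConstraintSystem.Carrier 𝒞)
                                 (SoftConstraintSystem.signature 𝒞)) where

  open SoftConstraintSystem 𝒞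
  open Definitions Ψ
  open Semantics 𝒞 Ψ using (Proc)
  open ExtSignature semiring public using (Σᴱ)

  -- Process names become predicate symbols distinct from those of 𝒫.
  signatureᴱ : Signature s
  signatureᴱ = record
    { functions  = functions signature
    ; predicates = record
      { Symbol = Symbol (predicates signature) ⊎ Fin size
      ; arity  = [ arity (predicates signature) , arityᴺ ]′
      }
    }

  Form : ℕ → Set (a ⊔ s)
  Form = Formula (ExtLabel Carrier) signatureᴱ

  inclusion : Atom signature n → Atom signatureᴱ n
  inclusion (p · ts) = inj₁ p · ts

  open Embedding {S = signature} {S′ = signatureᴱ} (‵_ {A = Carrier}) inclusion

  ⟦_⟧ᶜ : Con n → Form n
  ⟦_⟧ᶜ = formula

  callFormula : (p : Fin size) → Vec (Var n) (arityᴺ p) → Form n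
  callFormula p ys = ![ 𝔡 ] atom (inj₂ p · Vec.map var ys)

  mutual
    ⟦_⟧ᴾ : Proc n → Form n
    ⟦ tell c ⟧ᴾ              = ![ 𝔭 ] ⟦ c ⟧ᶜ
    ⟦ asks ((c , P) ∷ bs) ⟧ᴾ = ![ 𝔭 ] branches c P bs
    ⟦ P ∥ Q ⟧ᴾ               = ⟦ P ⟧ᴾ ⊗ ⟦ Q ⟧ᴾ
    ⟦ local P ⟧ᴾ             = ![ 𝔭 ] ∃ᶠ ⟦ P ⟧ᴾ
    ⟦ call p ys ⟧ᴾ           = callFormula p ys

    -- (c ⊸ ⟦P⟧) & (c₁ ⊸ ⟦P₁⟧) & ⋯ & (cₖ ⊸ ⟦Pₖ⟧)
    branches : Con n → Proc n → List (Con n × Proc n) → Form n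
    branches c P []               = ⟦ c ⟧ᶜ ⊸ ⟦ P ⟧ᴾ
    branches c P ((c′ , P′) ∷ bs) = (⟦ c ⟧ᶜ ⊸ ⟦ P ⟧ᴾ) & branches c′ P′ bs

  ⟦_⟧ᴰ : Fin size → Form 0
  ⟦ p ⟧ᴰ = ![ 𝔲 ] ∀⋆ (callFormula p (Vec.map bound (Vec.allFin (arityᴺ p))) ⊸ ⟦ body p ⟧ᴾ)

  ⟦Ψ⟧ : List (Form 0)
  ⟦Ψ⟧ = List.map ⟦_⟧ᴰ (allFin size)

  ⟦Δ⟧ : List (Form 0)
  ⟦Δ⟧ = List.map (λ δ → ![ ‵ ⊤A ] axiomFormula δ) axioms

{-# OPTIONS --safe #-}

-- Both directions rest on phase semantics: formulas denote sets of states, in a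
-- commutative monoid, that are closed with respect to a relation x ⊩ o between
-- states and observations, and provable sequents are valid.
--
-- With multisets of formulas as states and provability as ⊩ this gives the
-- admissibility of cut (Okada).  By cut, executions can be followed backwards:
-- if the encoding of the target of a transition proves G = (∃X.d) ⊗ ⊤, where X
-- and d belong to the last configuration, then so does that of its source.  The
-- names hidden on the way all lie in X, so they are not free in G and serve as
-- eigenvariables.
--
-- Conversely, let states be multisets of processes and constraints, and let
-- (Γ, D) ⊩ o mean that Γ can run from the store D to a store entailing o.  In
-- this model Δ and Ψ are valid, P belongs to the denotation of its encoding, and
-- the states in the denotation of a constraint c can run to a store entailing c.
-- Hence validity of the sequent provides an execution.
module Submission where

open import Defs
open import Algebra.Bundles using (CommutativeMonoid)
open import Algebra.Construct.DirectProduct using (commutativeMonoid)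
import Algebra.Solver.CommutativeMonoid as CommutativeMonoidSolver
open import Data.Bool.Base using (true; false)
open import Data.Fin.Base using (Fin; zero; suc)
open import Data.List.Base as List using (List; []; _∷_; [_]; _++_; concatMap)
import Data.List.Properties as List
open import Data.List.Membership.Propositional using (_∈_; _∉_; find)
open import Data.List.Membership.Propositional.Properties
  using (∈-++⁺ˡ; ∈-++⁺ʳ; ∈-++⁻; ∈-map⁺; ∈-map⁻; ∈-allFin; ∈-concatMap⁻; ∈-∃++)
open import Data.List.NonEmpty.Base as List⁺ using (List⁺; _∷_; toList)
open import Data.List.Relation.Binary.BagAndSetEquality using (_∼[_]_; set)
open import Data.List.Relation.Binary.Disjoint.Propositional using (Disjoint)
open import Data.List.Relation.Binary.Permutation.Propositional as ↭
  using (_↭_; ↭-refl; ↭-sym; ↭-reflexive)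
open import Data.List.Relation.Binary.Permutation.Propositional.Properties
  using (map⁺; ++-comm; ++⁺ˡ; ++⁺ʳ; ++-identityʳ; ++-commutativeMonoid; All-resp-↭; ↭-empty-inv)
  renaming (shift to ↭-shift)
open import Data.List.Relation.Binary.Pointwise.Base using (Pointwise; []; _∷_)
open import Data.List.Relation.Binary.Subset.Propositional using (_⊆_)
open import Data.List.Relation.Binary.Subset.Propositional.Properties
  using (⊆-reflexive) renaming (++⁺ to ++-mono)
open import Data.List.Relation.Unary.All as All using (All; []; _∷_)
import Data.List.Relation.Unary.All.Properties as All
open import Data.List.Relation.Unary.Any using (here; there)
open import Data.Nat.Base as ℕ using (ℕ; zero; suc; _≡ᵇ_)
open import Data.Nat.ListAction using (sum)
import Data.Nat.Properties as ℕ
open import Data.Product.Base using (_×_; _,_; ∃; ∃-syntax; Σ-syntax; proj₁; proj₂)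
open import Data.Sum.Base using (_⊎_; inj₁; inj₂)
open import Data.Unit.Base using (tt)
open import Data.Unit.Polymorphic.Base using (⊤)
open import Data.Vec.Base as Vec using (Vec; []; _∷_)
import Data.Vec.Properties as Vec
open import Function.Base using (id; _∘_)
open import Function.Bundles using (_⇔_; mk⇔; Equivalence)
open import Level using (Level; 0ℓ; _⊔_) renaming (suc to lsuc)
open import Relation.Binary.Construct.Closure.ReflexiveTransitive as Star using (_◅_)
open import Relation.Binary.PropositionalEquality
  using (_≡_; _≢_; _≗_; refl; sym; trans; cong; cong₂; subst; subst₂; module ≡-Reasoning)
open import Relation.Binary.Structures using (IsPreorder)
open import Relation.Nullary using (contradiction)
open import Relation.Unary using (Pred)

private
  variable
    a b s t : Level
    m n k : ℕ

-- A derivation may split contexts, promote and interleave left rules in ways that match no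
-- execution, so it is not normalised but interpreted, each rule once. For this the observations are
-- all formulas over `𝒜` and not just the goal `c`: closure tests a state against every observation,
-- so the guard of an `ask` can be observed on the way to another goal. Two obstacles shape the
-- rest. The first is reuse: a store is read repeatedly although it need not be a box. Constraints
-- are built from `𝟏`, `⊗`, `∃` and boxes with unbounded labels, which makes weakening and
-- contraction derivable for them. Processes may not be copied, and whatever remains of them at the
-- end is absorbed by `⊤`. The second is hidden names, which may clash with names of `c`. Forwards,
-- this is why `∃X.d` and not `c` is carried back along an execution; backwards, every new name is
-- chosen outside `c`, so that the final entailment survives hiding.

∈-concatMap-++⁻ : {A : Set a} {B : Set b} (f : A → List B) (xs : List A) {ys : List A} {y : B} →
                  y ∈ concatMap f (xs ++ ys) → y ∈ concatMap f xs ⊎ y ∈ concatMap f ys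
∈-concatMap-++⁻ f xs {ys} y∈ = ∈-++⁻ (concatMap f xs) (⊆-reflexive (List.concatMap-++ f xs ys) y∈)

-- Substitution

module _ {F : Symbols s} where

  -- `fvᵛ` of a bound index is empty, so agreement on indices is total and only names are restricted
  -- to `xs`. Eigenvariables need this restriction: an environment may be changed at a name that is
  -- fresh for a formula.
  Agree : List Name → Subst F m n → Subst F m n → Set s
  Agree xs σ τ = ∀ v → fvᵛ v ⊆ xs → σ v ≡ τ v

  agree : {σ τ : Subst F m n} → σ ≗ τ → ∀ {xs} → Agree xs σ τ
  agree σ≗τ v _ = σ≗τ v

  agree-⊆ : ∀ {xs ys} {σ τ : Subst F m n} → xs ⊆ ys → Agree ys σ τ → Agree xs σ τ
  agree-⊆ xs⊆ys h v v⊆xs = h v (xs⊆ys ∘ v⊆xs)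

  agreeˡ : ∀ {xs ys} {σ τ : Subst F m n} → Agree (xs ++ ys) σ τ → Agree xs σ τ
  agreeˡ = agree-⊆ ∈-++⁺ˡ

  agreeʳ : ∀ xs {ys} {σ τ : Subst F m n} → Agree (xs ++ ys) σ τ → Agree ys σ τ
  agreeʳ xs = agree-⊆ (∈-++⁺ʳ xs)

  mutual
    subᵗ-cong : {σ τ : Subst F m n} (t : Term F m) → Agree (fvᵗ t) σ τ → subᵗ σ t ≡ subᵗ τ t
    subᵗ-cong (var v)    h = h v id
    subᵗ-cong (fun f ts) h = cong (fun f) (subᵗˢ-cong ts h)

    subᵗˢ-cong : {σ τ : Subst F m n} (ts : Vec (Term F m) k) → Agree (fvᵗˢ ts) σ τ →
                 subᵗˢ σ ts ≡ subᵗˢ τ ts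
    subᵗˢ-cong []       h = refl
    subᵗˢ-cong (t ∷ ts) h =
      cong₂ _∷_ (subᵗ-cong t (agreeˡ h)) (subᵗˢ-cong ts (agreeʳ (fvᵗ t) h))

  mutual
    subᵗ-comp : ∀ {l} {τ : Subst F m l} {σ : Subst F n m} t →
                subᵗ τ (subᵗ σ t) ≡ subᵗ (subᵗ τ ∘ σ) t
    subᵗ-comp (var v)    = refl
    subᵗ-comp (fun f ts) = cong (fun f) (subᵗˢ-comp ts)

    subᵗˢ-comp : ∀ {l} {τ : Subst F m l} {σ : Subst F n m} (ts : Vec (Term F n) k) →
                 subᵗˢ τ (subᵗˢ σ ts) ≡ subᵗˢ (subᵗ τ ∘ σ) ts
    subᵗˢ-comp []       = refl
    subᵗˢ-comp (t ∷ ts) = cong₂ _∷_ (subᵗ-comp t) (subᵗˢ-comp ts)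

  mutual
    subᵗ-var : (t : Term F m) → subᵗ var t ≡ t
    subᵗ-var (var v)    = refl
    subᵗ-var (fun f ts) = cong (fun f) (subᵗˢ-var ts)

    subᵗˢ-var : (ts : Vec (Term F m) k) → subᵗˢ var ts ≡ ts
    subᵗˢ-var []       = refl
    subᵗˢ-var (t ∷ ts) = cong₂ _∷_ (subᵗ-var t) (subᵗˢ-var ts)

  subᵗˢ-map-var : (σ : Subst F m n) (ys : Vec (Var m) k) →
                  subᵗˢ σ (Vec.map var ys) ≡ Vec.map σ ys
  subᵗˢ-map-var σ []       = refl
  subᵗˢ-map-var σ (y ∷ ys) = cong (σ y ∷_) (subᵗˢ-map-var σ ys)

  weakenᵗ : Term F n → Term F (suc n)
  weakenᵗ = subᵗ (var ∘ shift)

  liftˢ-weakenᵗ : (τ : Subst F m n) (t : Term F m) →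
                  subᵗ (liftˢ τ) (weakenᵗ t) ≡ weakenᵗ (subᵗ τ t)
  liftˢ-weakenᵗ τ t =
    trans (subᵗ-comp t)
      (trans (subᵗ-cong t (agree λ { (bound i) → refl ; (free x) → refl }))
        (sym (subᵗ-comp t)))

  liftˢ-agree : ∀ {xs} {σ τ : Subst F m n} → Agree xs σ τ → Agree xs (liftˢ σ) (liftˢ τ)
  liftˢ-agree h (bound zero)    p = refl
  liftˢ-agree h (bound (suc i)) p = cong weakenᵗ (h (bound i) λ ())
  liftˢ-agree h (free x)        p = cong weakenᵗ (h (free x) p)

  liftˢ-comp : ∀ {l} (τ : Subst F m l) (σ : Subst F n m) →
               subᵗ (liftˢ τ) ∘ liftˢ σ ≗ liftˢ (subᵗ τ ∘ σ)
  liftˢ-comp τ σ (bound zero)    = refl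
  liftˢ-comp τ σ (bound (suc i)) = liftˢ-weakenᵗ τ (σ (bound i))
  liftˢ-comp τ σ (free x)        = liftˢ-weakenᵗ τ (σ (free x))

  liftˢ-ren : (ρ : Renaming m n) → liftˢ {F = F} (var ∘ ρ) ≗ var ∘ liftʳ ρ
  liftˢ-ren ρ (bound zero)    = refl
  liftˢ-ren ρ (bound (suc i)) = refl
  liftˢ-ren ρ (free x)        = refl

  liftˢ-var : liftˢ {F = F} {n} var ≗ var
  liftˢ-var (bound zero)    = refl
  liftˢ-var (bound (suc i)) = refl
  liftˢ-var (free x)        = refl

  infixl 5 _▸_
  -- Extension of an environment by a value for the innermost index: `liftˢ σ` followed by
  -- `instantiate t`, in one pass. It lets quantifiers be interpreted without substituting into
  -- formulas.
  _▸_ : Subst F m n → Term F n → Subst F (suc m) n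
  (σ ▸ t) (bound zero)    = t
  (σ ▸ t) (bound (suc i)) = σ (bound i)
  (σ ▸ t) (free x)        = σ (free x)

  instantiate-weakenᵗ : (u t : Term F n) → subᵗ (instantiate u) (weakenᵗ t) ≡ t
  instantiate-weakenᵗ u t =
    trans (subᵗ-comp t)
      (trans (subᵗ-cong t (agree λ { (bound i) → refl ; (free x) → refl })) (subᵗ-var t))

  instantiate-liftˢ : (σ : Subst F m n) (t : Term F n) →
                      subᵗ (instantiate t) ∘ liftˢ σ ≗ σ ▸ t
  instantiate-liftˢ σ t (bound zero)    = refl
  instantiate-liftˢ σ t (bound (suc i)) = instantiate-weakenᵗ t (σ (bound i))
  instantiate-liftˢ σ t (free x)        = instantiate-weakenᵗ t (σ (free x))

  ▸-liftˢ : ∀ {l} (τ : Subst F m l) (σ : Subst F n m) t →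
            subᵗ (τ ▸ t) ∘ liftˢ σ ≗ (subᵗ τ ∘ σ) ▸ t
  ▸-liftˢ τ σ t (bound zero)    = refl
  ▸-liftˢ τ σ t (bound (suc i)) =
    trans (subᵗ-comp (σ (bound i)))
      (subᵗ-cong (σ (bound i)) (agree λ { (bound i) → refl ; (free x) → refl }))
  ▸-liftˢ τ σ t (free x) =
    trans (subᵗ-comp (σ (free x)))
      (subᵗ-cong (σ (free x)) (agree λ { (bound i) → refl ; (free x) → refl }))

  ▸-agree : ∀ {xs} {σ τ : Subst F m n} t → Agree xs σ τ → Agree xs (σ ▸ t) (τ ▸ t)
  ▸-agree t h (bound zero)    p = refl
  ▸-agree t h (bound (suc i)) p = h (bound i) λ ()
  ▸-agree t h (free x)        p = h (free x) p

  open-abstractName : ∀ x → subᵗ (instantiate (var (free x))) ∘ abstractName x ≗ var {F = F} {n}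
  open-abstractName x (bound i) = refl
  open-abstractName x (free y) with x ≡ᵇ y | ℕ.≡ᵇ⇒≡ x y
  ... | true  | x≡y = cong (var ∘ free) (x≡y tt)
  ... | false | _   = refl

  fv-abstractName : ∀ x {y} (v : Var n) → y ∈ fvᵗ {F = F} (abstractName x v) → x ≢ y × y ∈ fvᵛ v
  fv-abstractName x (free z) y∈ with x ≡ᵇ z | ℕ.≡⇒≡ᵇ x z
  fv-abstractName x (free z) (here refl) | false | x≢z = x≢z , here refl

  mutual
    fvᵗ-sub : ∀ (σ : Subst F m n) t {y} → y ∈ fvᵗ (subᵗ σ t) →
              ∃[ v ] fvᵛ v ⊆ fvᵗ t × y ∈ fvᵗ (σ v)
    fvᵗ-sub σ (var v)    y∈ = v , id , y∈
    fvᵗ-sub σ (fun f ts) y∈ = fvᵗˢ-sub σ ts y∈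

    fvᵗˢ-sub : ∀ (σ : Subst F m n) (ts : Vec (Term F m) k) {y} → y ∈ fvᵗˢ (subᵗˢ σ ts) →
               ∃[ v ] fvᵛ v ⊆ fvᵗˢ ts × y ∈ fvᵗ (σ v)
    fvᵗˢ-sub σ (t ∷ ts) y∈ with ∈-++⁻ (fvᵗ (subᵗ σ t)) y∈
    ... | inj₁ q = let v , v⊆ , r = fvᵗ-sub σ t q in v , ∈-++⁺ˡ ∘ v⊆ , r
    ... | inj₂ q = let v , v⊆ , r = fvᵗˢ-sub σ ts q in v , ∈-++⁺ʳ (fvᵗ t) ∘ v⊆ , r

  fvᵗ-weakenᵗ : (t : Term F n) → fvᵗ (weakenᵗ t) ⊆ fvᵗ t
  fvᵗ-weakenᵗ t y∈ with fvᵗ-sub (var ∘ shift) t y∈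
  ... | free x , v⊆ , q = v⊆ q

  fv-liftˢ : ∀ {xs y} (σ : Subst F m n) →
             (∃[ v ] fvᵛ v ⊆ xs × y ∈ fvᵗ (liftˢ σ v)) → ∃[ v ] fvᵛ v ⊆ xs × y ∈ fvᵗ (σ v)
  fv-liftˢ σ (bound (suc i) , v⊆ , y∈) = bound i , (λ ()) , fvᵗ-weakenᵗ (σ (bound i)) y∈
  fv-liftˢ σ (free x , v⊆ , y∈)        = free x , v⊆ , fvᵗ-weakenᵗ (σ (free x)) y∈

module _ {S : Signature s} {L : Set a} where

  private
    Fm : ℕ → Set (a ⊔ s)
    Fm = Formula L S

    Sub : ℕ → ℕ → Set s
    Sub = Subst (functions S)

  subᵃ-cong : {σ τ : Sub m n} (A : Atom S m) → Agree (fvᵃ A) σ τ → subᵃ σ A ≡ subᵃ τ A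
  subᵃ-cong (p · ts) h = cong (p ·_) (subᵗˢ-cong ts h)

  subᵃ-comp : ∀ {l} {τ : Sub m l} {σ : Sub n m} (A : Atom S n) →
              subᵃ τ (subᵃ σ A) ≡ subᵃ (subᵗ τ ∘ σ) A
  subᵃ-comp (p · ts) = cong (p ·_) (subᵗˢ-comp ts)

  subᶠ-cong : {σ τ : Sub m n} (F : Fm m) → Agree (fvᶠ F) σ τ → subᶠ σ F ≡ subᶠ τ F
  subᶠ-cong (atom A)   h = cong atom (subᵃ-cong A h)
  subᶠ-cong 𝟏          h = refl
  subᶠ-cong ⊤ᶠ         h = refl
  subᶠ-cong (F ⊗ G)    h = cong₂ _⊗_ (subᶠ-cong F (agreeˡ h)) (subᶠ-cong G (agreeʳ (fvᶠ F) h))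
  subᶠ-cong (F ⊸ G)    h = cong₂ _⊸_ (subᶠ-cong F (agreeˡ h)) (subᶠ-cong G (agreeʳ (fvᶠ F) h))
  subᶠ-cong (F & G)    h = cong₂ _&_ (subᶠ-cong F (agreeˡ h)) (subᶠ-cong G (agreeʳ (fvᶠ F) h))
  subᶠ-cong (∃ᶠ F)     h = cong ∃ᶠ (subᶠ-cong F (liftˢ-agree h))
  subᶠ-cong (∀ᶠ F)     h = cong ∀ᶠ (subᶠ-cong F (liftˢ-agree h))
  subᶠ-cong (![ l ] F) h = cong (![ l ]_) (subᶠ-cong F h)

  subᶠ-fuse : ∀ {l} {τ : Sub m l} {σ : Sub n m} {ρ : Sub n l} (F : Fm n) →
              Agree (fvᶠ F) (subᵗ τ ∘ σ) ρ → subᶠ τ (subᶠ σ F) ≡ subᶠ ρ F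
  subᶠ-fuse {τ = τ} {σ} {ρ} F h = trans (comp F) (subᶠ-cong F h)
    where
    comp : ∀ {m n l} {τ : Sub m l} {σ : Sub n m} (F : Fm n) →
           subᶠ τ (subᶠ σ F) ≡ subᶠ (subᵗ τ ∘ σ) F
    lifted : ∀ {m n l} {τ : Sub m l} {σ : Sub n m} (F : Fm (suc n)) →
             subᶠ (liftˢ τ) (subᶠ (liftˢ σ) F) ≡ subᶠ (liftˢ (subᵗ τ ∘ σ)) F
    lifted {τ = τ} {σ} F = trans (comp F) (subᶠ-cong F (agree (liftˢ-comp τ σ)))
    comp (atom A)   = cong atom (subᵃ-comp A)
    comp 𝟏          = refl
    comp ⊤ᶠ         = refl
    comp (F ⊗ G)    = cong₂ _⊗_ (comp F) (comp G)
    comp (F ⊸ G)    = cong₂ _⊸_ (comp F) (comp G)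
    comp (F & G)    = cong₂ _&_ (comp F) (comp G)
    comp (∃ᶠ F)     = cong ∃ᶠ (lifted F)
    comp (∀ᶠ F)     = cong ∀ᶠ (lifted F)
    comp (![ l ] F) = cong (![ l ]_) (comp F)

  subᶠ-var : (F : Fm n) → subᶠ var F ≡ F
  subᶠ-var (atom (p · ts)) = cong (λ us → atom (p · us)) (subᵗˢ-var ts)
  subᶠ-var 𝟏          = refl
  subᶠ-var ⊤ᶠ         = refl
  subᶠ-var (F ⊗ G)    = cong₂ _⊗_ (subᶠ-var F) (subᶠ-var G)
  subᶠ-var (F ⊸ G)    = cong₂ _⊸_ (subᶠ-var F) (subᶠ-var G)
  subᶠ-var (F & G)    = cong₂ _&_ (subᶠ-var F) (subᶠ-var G)
  subᶠ-var (∃ᶠ F)     = cong ∃ᶠ (trans (subᶠ-cong F (agree liftˢ-var)) (subᶠ-var F))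
  subᶠ-var (∀ᶠ F)     = cong ∀ᶠ (trans (subᶠ-cong F (agree liftˢ-var)) (subᶠ-var F))
  subᶠ-var (![ l ] F) = cong (![ l ]_) (subᶠ-var F)

  subᶠ-id : {σ : Sub n n} (F : Fm n) → σ ≗ var → subᶠ σ F ≡ F
  subᶠ-id F h = trans (subᶠ-cong F (agree h)) (subᶠ-var F)

  open-lift : (σ : Sub m n) (t : Term (functions S) n) (F : Fm (suc m)) →
              subᶠ (instantiate t) (subᶠ (liftˢ σ) F) ≡ subᶠ (σ ▸ t) F
  open-lift σ t F = subᶠ-fuse F (agree (instantiate-liftˢ σ t))

  -- A name of the result is traced back to a variable, since it may stem from a bound index. For an
  -- index the inclusion says nothing, and callers inspect what `σ` does to it.
  fvᶠ-sub : (σ : Sub m n) (F : Fm m) → ∀ {y} → y ∈ fvᶠ (subᶠ σ F) →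
            ∃[ v ] fvᵛ v ⊆ fvᶠ F × y ∈ fvᵗ (σ v)
  fvᶠ-sub₂ : (σ : Sub m n) (F G : Fm m) → ∀ {y} → y ∈ fvᶠ (subᶠ σ F) ++ fvᶠ (subᶠ σ G) →
             ∃[ v ] fvᵛ v ⊆ fvᶠ F ++ fvᶠ G × y ∈ fvᵗ (σ v)
  fvᶠ-sub σ (atom (p · ts)) y∈ = fvᵗˢ-sub σ ts y∈
  fvᶠ-sub σ (F ⊗ G)         y∈ = fvᶠ-sub₂ σ F G y∈
  fvᶠ-sub σ (F ⊸ G)         y∈ = fvᶠ-sub₂ σ F G y∈
  fvᶠ-sub σ (F & G)         y∈ = fvᶠ-sub₂ σ F G y∈
  fvᶠ-sub σ (∃ᶠ F)          y∈ = fv-liftˢ σ (fvᶠ-sub (liftˢ σ) F y∈)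
  fvᶠ-sub σ (∀ᶠ F)          y∈ = fv-liftˢ σ (fvᶠ-sub (liftˢ σ) F y∈)
  fvᶠ-sub σ (![ l ] F)      y∈ = fvᶠ-sub σ F y∈
  fvᶠ-sub₂ σ F G y∈ with ∈-++⁻ (fvᶠ (subᶠ σ F)) y∈
  ... | inj₁ q = let v , v⊆ , r = fvᶠ-sub σ F q in v , ∈-++⁺ˡ ∘ v⊆ , r
  ... | inj₂ q = let v , v⊆ , r = fvᶠ-sub σ G q in v , ∈-++⁺ʳ (fvᶠ F) ∘ v⊆ , r

module _ {S : Signature s} {A : Set a} where

  private
    Sub : ℕ → ℕ → Set s
    Sub = Subst (functions S)

  subᶜ-cong : {σ τ : Sub m n} → σ ≗ τ → (c : Constraint A S m) → subᶜ σ c ≡ subᶜ τ c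
  subᶜ-cong h 𝟏            = refl
  subᶜ-cong h (c ⊗ d)      = cong₂ _⊗_ (subᶜ-cong h c) (subᶜ-cong h d)
  subᶜ-cong h (∃ᶜ c)       = cong ∃ᶜ (subᶜ-cong (λ v → liftˢ-agree (agree h) v id) c)
  subᶜ-cong h (![ l ] B)   = cong (![ l ]_) (subᵃ-cong {L = A} B (agree h))
  subᶜ-cong h (![ l ]⨂ (B ∷ Bs)) =
    cong (![ l ]⨂_) (cong₂ _∷_ (subᵃ-cong {L = A} B (agree h))
                               (List.map-cong (λ B → subᵃ-cong {L = A} B (agree h)) Bs))

  subᶜ-comp : ∀ {l} {τ : Sub m l} {σ : Sub n m} (c : Constraint A S n) →
              subᶜ τ (subᶜ σ c) ≡ subᶜ (subᵗ τ ∘ σ) c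
  subᶜ-comp 𝟏          = refl
  subᶜ-comp (c ⊗ d)    = cong₂ _⊗_ (subᶜ-comp c) (subᶜ-comp d)
  subᶜ-comp (∃ᶜ c)     = cong ∃ᶜ (trans (subᶜ-comp c) (subᶜ-cong (liftˢ-comp _ _) c))
  subᶜ-comp (![ l ] B) = cong (![ l ]_) (subᵃ-comp {L = A} B)
  subᶜ-comp (![ l ]⨂ (B ∷ Bs)) =
    cong (![ l ]⨂_) (cong₂ _∷_ (subᵃ-comp {L = A} B)
      (trans (sym (List.map-∘ Bs)) (List.map-cong (subᵃ-comp {L = A}) Bs)))

  subᶜ-var : (c : Constraint A S n) → subᶜ var c ≡ c
  subᶜ-var 𝟏          = refl
  subᶜ-var (c ⊗ d)    = cong₂ _⊗_ (subᶜ-var c) (subᶜ-var d)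
  subᶜ-var (∃ᶜ c)     = cong ∃ᶜ (trans (subᶜ-cong liftˢ-var c) (subᶜ-var c))
  subᶜ-var (![ l ] (p · ts)) = cong (λ us → ![ l ] (p · us)) (subᵗˢ-var ts)
  subᶜ-var (![ l ]⨂ ((p · ts) ∷ Bs)) =
    cong (![ l ]⨂_) (cong₂ _∷_ (cong (p ·_) (subᵗˢ-var ts))
      (trans (List.map-cong (λ { (q · us) → cong (q ·_) (subᵗˢ-var us) }) Bs) (List.map-id Bs)))

  subᶜ-id : {σ : Sub n n} (c : Constraint A S n) → σ ≗ var → subᶜ σ c ≡ c
  subᶜ-id c h = trans (subᶜ-cong h c) (subᶜ-var c)

liftʳ-shift : (τ : Renaming m n) → liftʳ τ ∘ shift ≗ shift ∘ τ
liftʳ-shift τ (bound i) = refl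
liftʳ-shift τ (free x)  = refl

liftʳ-fuse : ∀ {l} {τ : Renaming m l} {ρ : Renaming n m} {π : Renaming n l} →
             τ ∘ ρ ≗ π → liftʳ τ ∘ liftʳ ρ ≗ liftʳ π
liftʳ-fuse         h (bound zero)    = refl
liftʳ-fuse {τ = τ} h (bound (suc i)) = trans (liftʳ-shift τ _) (cong shift (h (bound i)))
liftʳ-fuse {τ = τ} h (free x)        = trans (liftʳ-shift τ _) (cong shift (h (free x)))

liftʳ-id : {ρ : Renaming n n} → ρ ≗ id → liftʳ ρ ≗ id
liftʳ-id h (bound zero)    = refl
liftʳ-id h (bound (suc i)) = cong shift (h (bound i))
liftʳ-id h (free x)        = cong shift (h (free x))

module _ {A : Set a} {S : Signature s} {N : Symbols 0ℓ} where

  subᶜ-fuseʳ : ∀ {l} {τ : Renaming m l} {ρ : Renaming n m} {π : Renaming n l} → τ ∘ ρ ≗ π →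
               (c : Constraint A S n) → subᶜ (var ∘ τ) (subᶜ (var ∘ ρ) c) ≡ subᶜ (var ∘ π) c
  subᶜ-fuseʳ h c = trans (subᶜ-comp c) (subᶜ-cong (cong var ∘ h) c)

  mutual
    renᴾ-fuse : ∀ {l} {τ : Renaming m l} {ρ : Renaming n m} {π : Renaming n l} → τ ∘ ρ ≗ π →
                (P : Process A S N n) → renᴾ τ (renᴾ ρ P) ≡ renᴾ π P
    renᴾ-fuse h (tell c)              = cong tell (subᶜ-fuseʳ h c)
    renᴾ-fuse h (asks ((c , P) ∷ bs)) =
      cong asks (cong₂ _∷_ (cong₂ _,_ (subᶜ-fuseʳ h c) (renᴾ-fuse h P)) (renᴮ-fuse h bs))
    renᴾ-fuse h (P ∥ Q)               = cong₂ _∥_ (renᴾ-fuse h P) (renᴾ-fuse h Q)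
    renᴾ-fuse h (local P)             = cong local (renᴾ-fuse (liftʳ-fuse h) P)
    renᴾ-fuse h (call p ys)           =
      cong (call p) (trans (sym (Vec.map-∘ _ _ ys)) (Vec.map-cong h ys))

    renᴮ-fuse : ∀ {l} {τ : Renaming m l} {ρ : Renaming n m} {π : Renaming n l} → τ ∘ ρ ≗ π →
                (bs : List (Constraint A S n × Process A S N n)) →
                renᴮ τ (renᴮ ρ bs) ≡ renᴮ π bs
    renᴮ-fuse h []             = refl
    renᴮ-fuse h ((c , P) ∷ bs) =
      cong₂ _∷_ (cong₂ _,_ (subᶜ-fuseʳ h c) (renᴾ-fuse h P)) (renᴮ-fuse h bs)

  mutual
    renᴾ-id : {ρ : Renaming n n} → ρ ≗ id → (P : Process A S N n) → renᴾ ρ P ≡ P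
    renᴾ-id h (tell c)              = cong tell (subᶜ-id c (cong var ∘ h))
    renᴾ-id h (asks ((c , P) ∷ bs)) =
      cong asks (cong₂ _∷_ (cong₂ _,_ (subᶜ-id c (cong var ∘ h)) (renᴾ-id h P)) (renᴮ-id h bs))
    renᴾ-id h (P ∥ Q)               = cong₂ _∥_ (renᴾ-id h P) (renᴾ-id h Q)
    renᴾ-id h (local P)             = cong local (renᴾ-id (liftʳ-id h) P)
    renᴾ-id h (call p ys)           = cong (call p) (trans (Vec.map-cong h ys) (Vec.map-id ys))

    renᴮ-id : {ρ : Renaming n n} → ρ ≗ id →
              (bs : List (Constraint A S n × Process A S N n)) → renᴮ ρ bs ≡ bs
    renᴮ-id h []             = refl
    renᴮ-id h ((c , P) ∷ bs) =
      cong₂ _∷_ (cong₂ _,_ (subᶜ-id c (cong var ∘ h)) (renᴾ-id h P)) (renᴮ-id h bs)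

-- Constraints read as formulas over other labels and predicates

extend : (S : Signature s) → Symbols s → Signature s
extend S P = record { functions = functions S ; predicates = P }

fvᶠ-∀⋆ : {L : Set a} {S : Signature s} (F : Formula L S n) → fvᶠ (∀⋆ F) ≡ fvᶠ F
fvᶠ-∀⋆ {n = zero}  F = refl
fvᶠ-∀⋆ {n = suc n} F = fvᶠ-∀⋆ (∀ᶠ F)

-- Constraints become formulas both over `𝒜` and over the labels of the encoding. The signatures
-- share their function symbols, so the same substitutions act before and after the translation, and
-- the lemmas are proved once for both readings.
module Embedded {A : Set a} {L : Set b} {S : Signature s} {P : Symbols s} (label : A → L)
                (atomᴱ : ∀ {n} → Atom S n → Atom (extend S P) n)
                (atomᴱ-sub : ∀ {m n} (σ : Subst (functions S) m n) B →
                             atomᴱ (subᵃ σ B) ≡ subᵃ σ (atomᴱ B))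
                (atomᴱ-fv : ∀ {n} (B : Atom S n) → fvᵃ (atomᴱ B) ≡ fvᵃ B) where

  open Embedding {S = S} {S′ = extend S P} label atomᴱ public

  formula-sub : (σ : Subst (functions S) m n) (c : Constraint A S m) →
                formula (subᶜ σ c) ≡ subᶠ σ (formula c)
  formula-sub σ 𝟏            = refl
  formula-sub σ (c ⊗ d)      = cong₂ _⊗_ (formula-sub σ c) (formula-sub σ d)
  formula-sub σ (∃ᶜ c)       = cong ∃ᶠ (formula-sub (liftˢ σ) c)
  formula-sub σ (![ l ] B)   = cong (λ B → ![ label l ] atom B) (atomᴱ-sub σ B)
  formula-sub {m} {n} σ (![ l ]⨂ (B ∷ Bs)) = cong (![ label l ]_) (go B Bs)
    where
    go : (B : Atom S m) (Bs : List (Atom S m)) →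
         List⁺.foldr₁ _⊗_
             (List⁺.map (λ A → ![ label l ] atom (atomᴱ A)) (List⁺.map (subᵃ σ) (B ∷ Bs)))
           ≡ subᶠ σ (List⁺.foldr₁ _⊗_ (List⁺.map (λ A → ![ label l ] atom (atomᴱ A)) (B ∷ Bs)))
    go B []        = cong (λ B → ![ label l ] atom B) (atomᴱ-sub σ B)
    go B (B′ ∷ Bs) = cong₂ _⊗_ (cong (λ B → ![ label l ] atom B) (atomᴱ-sub σ B)) (go B′ Bs)

  formula-fv : (c : Constraint A S n) → fvᶠ (formula c) ⊆ fvᶜ c
  formula-fv (c ⊗ d)      = ++-mono (formula-fv c) (formula-fv d)
  formula-fv (∃ᶜ c)       = formula-fv c
  formula-fv (![ l ] B)   = ⊆-reflexive (atomᴱ-fv B)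
  formula-fv {n} (![ l ]⨂ (B ∷ Bs)) = go B Bs
    where
    go : (B : Atom S n) (Bs : List (Atom S n)) →
         fvᶠ (List⁺.foldr₁ _⊗_ (List⁺.map (λ A → ![ label l ] atom (atomᴱ A)) (B ∷ Bs)))
           ⊆ concatMap fvᵃ (B ∷ Bs)
    go B []        = ∈-++⁺ˡ ∘ ⊆-reflexive (atomᴱ-fv B)
    go B (B′ ∷ Bs) = ++-mono (⊆-reflexive (atomᴱ-fv B)) (go B′ Bs)

  formula-open : ∀ (σ : Subst (functions S) m n) t (c : Constraint A S (suc m)) →
                 formula (subᶜ (σ ▸ t) c) ≡ subᶠ (instantiate t) (formula (subᶜ (liftˢ σ) c))
  formula-open σ t c = trans (formula-sub (σ ▸ t) c)
    (trans (sym (open-lift σ t (formula c)))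
      (cong (subᶠ (instantiate t)) (sym (formula-sub (liftˢ σ) c))))

  formula-reopen : ∀ x (c : Constraint A S n) →
                   subᶠ (instantiate (var (free x))) (formula (subᶜ (abstractName x) c)) ≡ formula c
  formula-reopen x c = trans (cong (subᶠ (instantiate (var (free x)))) (formula-sub (abstractName x) c))
    (trans (subᶠ-fuse (formula c) (agree (open-abstractName x))) (subᶠ-var (formula c)))

  formula-abstract-fv : ∀ x (c : Constraint A S n) {y} →
                        y ∈ fvᶠ (formula (subᶜ (abstractName x) c)) → x ≢ y × y ∈ fvᶠ (formula c)
  formula-abstract-fv x c y∈
    with fvᶠ-sub (abstractName x) (formula c)
           (⊆-reflexive (cong fvᶠ (formula-sub (abstractName x) c)) y∈)
  ... | v , v⊆ , q = let x≢y , r = fv-abstractName x v q in x≢y , v⊆ r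

  axiomFormula-closed : (δ : Axiom A S) → fvᶠ (axiomFormula δ) ⊆ []
  axiomFormula-closed δ y∈
    with ∈-++⁻ (fvᶠ F) (⊆-reflexive (fvᶠ-∀⋆ (F ⊸ formula (Axiom.consequent δ))) y∈)
    where F = formula (Axiom.antecedent δ)
  ... | inj₁ q = ⊆-reflexive (Axiom.closedᵃ δ) (formula-fv (Axiom.antecedent δ) q)
  ... | inj₂ q = ⊆-reflexive (Axiom.closedᶜ δ) (formula-fv (Axiom.consequent δ) q)

-- Renaming and free names of encoded processes

module EncodingProperties {a s} (𝒞 : SoftConstraintSystem a s)
                          (Ψ : Definitions (SoftConstraintSystem.Carrier 𝒞)
                                           (SoftConstraintSystem.signature 𝒞)) where

  open SoftConstraintSystem 𝒞
  open Definitions Ψ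
  open Semantics 𝒞 Ψ
  open Encoding 𝒞 Ψ

  inclusion-sub : (σ : Subst (functions signature) m n) (A : Atom signature m) →
                  inclusion (subᵃ σ A) ≡ subᵃ σ (inclusion A)
  inclusion-sub σ (p · ts) = refl

  inclusion-fv : (A : Atom signature n) → fvᵃ (inclusion A) ≡ fvᵃ A
  inclusion-fv (p · ts) = refl

  module E₀ = Embedded {S = signature} {P = predicates signature} (id {A = Carrier}) id
                       (λ _ _ → refl) (λ _ → refl)
  module Eᴱ = Embedded {S = signature} {P = predicates signatureᴱ} (‵_ {A = Carrier}) inclusion
                       inclusion-sub inclusion-fv

  ⟦⟧ᶜ-ren : (ρ : Renaming m n) (c : Con m) → ⟦ subᶜ (var ∘ ρ) c ⟧ᶜ ≡ subᶠ (var ∘ ρ) ⟦ c ⟧ᶜ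
  ⟦⟧ᶜ-ren ρ = Eᴱ.formula-sub (var ∘ ρ)

  mutual
    ⟦⟧ᴾ-ren : (ρ : Renaming m n) (P : Proc m) → ⟦ renᴾ ρ P ⟧ᴾ ≡ subᶠ (var ∘ ρ) ⟦ P ⟧ᴾ
    ⟦⟧ᴾ-ren ρ (tell c)              = cong (![ 𝔭 ]_) (⟦⟧ᶜ-ren ρ c)
    ⟦⟧ᴾ-ren ρ (asks ((c , P) ∷ bs)) = cong (![ 𝔭 ]_) (branches-ren ρ c P bs)
    ⟦⟧ᴾ-ren ρ (P ∥ Q)               = cong₂ _⊗_ (⟦⟧ᴾ-ren ρ P) (⟦⟧ᴾ-ren ρ Q)
    ⟦⟧ᴾ-ren ρ (local P)             = cong (λ F → ![ 𝔭 ] ∃ᶠ F)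
      (trans (⟦⟧ᴾ-ren (liftʳ ρ) P) (subᶠ-cong ⟦ P ⟧ᴾ (agree (λ v → sym (liftˢ-ren ρ v)))))
    ⟦⟧ᴾ-ren ρ (call p ys)           = cong (λ us → ![ 𝔡 ] atom (inj₂ p · us))
      (trans (sym (Vec.map-∘ var ρ ys)) (sym (subᵗˢ-map-var (var ∘ ρ) ys)))

    branches-ren : (ρ : Renaming m n) (c : Con m) (P : Proc m) (bs : List (Con m × Proc m)) →
                   branches (subᶜ (var ∘ ρ) c) (renᴾ ρ P) (renᴮ ρ bs)
                     ≡ subᶠ (var ∘ ρ) (branches c P bs)
    branches-ren ρ c P []               = cong₂ _⊸_ (⟦⟧ᶜ-ren ρ c) (⟦⟧ᴾ-ren ρ P)
    branches-ren ρ c P ((c′ , P′) ∷ bs) =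
      cong₂ _&_ (cong₂ _⊸_ (⟦⟧ᶜ-ren ρ c) (⟦⟧ᴾ-ren ρ P)) (branches-ren ρ c′ P′ bs)

  fvᵗˢ-map-var : (ys : Vec (Var n) k) →
                 fvᵗˢ {F = functions signature} (Vec.map var ys) ≡ concatMap fvᵛ (Vec.toList ys)
  fvᵗˢ-map-var []       = refl
  fvᵗˢ-map-var (y ∷ ys) = cong (fvᵛ y ++_) (fvᵗˢ-map-var ys)

  mutual
    ⟦⟧ᴾ-fv : (P : Proc n) → fvᶠ ⟦ P ⟧ᴾ ⊆ fvᴾ P
    ⟦⟧ᴾ-fv (tell c)              = Eᴱ.formula-fv c
    ⟦⟧ᴾ-fv (asks ((c , P) ∷ bs)) = branches-fv c P bs
    ⟦⟧ᴾ-fv (P ∥ Q)               = ++-mono (⟦⟧ᴾ-fv P) (⟦⟧ᴾ-fv Q)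
    ⟦⟧ᴾ-fv (local P)             = ⟦⟧ᴾ-fv P
    ⟦⟧ᴾ-fv (call p ys)           = ⊆-reflexive (fvᵗˢ-map-var ys)

    branches-fv : (c : Con n) (P : Proc n) (bs : List (Con n × Proc n)) →
                  fvᶠ (branches c P bs) ⊆ fvᶜ c ++ fvᴾ P ++ fvᴮ bs
    branches-fv c P []               =
      ++-mono (Eᴱ.formula-fv c) (∈-++⁺ˡ ∘ ⟦⟧ᴾ-fv P)
    branches-fv c P ((c′ , P′) ∷ bs) =
      ⊆-reflexive (List.++-assoc (fvᶜ c) (fvᴾ P) _) ∘
      ++-mono (++-mono (Eᴱ.formula-fv c) (⟦⟧ᴾ-fv P)) (branches-fv c′ P′ bs)

  formals : ∀ p → Vec (Var (arityᴺ p)) (arityᴺ p)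
  formals p = Vec.map bound (Vec.allFin (arityᴺ p))

  ⟦⟧ᴰ-closed : ∀ p → fvᶠ ⟦ p ⟧ᴰ ⊆ []
  ⟦⟧ᴰ-closed p y∈
    with ∈-++⁻ (fvᶠ (callFormula p (formals p)))
               (⊆-reflexive (fvᶠ-∀⋆ (callFormula p (formals p) ⊸ ⟦ body p ⟧ᴾ)) y∈)
  ... | inj₁ q = ⊆-reflexive (trans (fvᵗˢ-map-var (formals p)) (fv-bound (Vec.allFin (arityᴺ p)))) q
    where
    fv-bound : (is : Vec (Fin m) k) → concatMap fvᵛ (Vec.toList (Vec.map bound is)) ≡ []
    fv-bound []       = refl
    fv-bound (i ∷ is) = fv-bound is
  ... | inj₂ q = ⊆-reflexive (closed p) (⟦⟧ᴾ-fv (body p) q)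

-- Phase semantics

Boxed : (Σ : SubexpSignature a) {S : Signature s} → Label Σ → List (Formula (Label Σ) S 0) →
        Set (a ⊔ s)
Boxed Σ l = All (λ H → ∃[ k ] ∃[ F ] H ≡ ![ k ] F × SubexpSignature._≼_ Σ l k)

-- An intuitionistic phase space with labelled modalities. `Modal l` takes the place of the
-- submonoid that interprets the ordinary exponential. It shrinks as `l` grows, as promotion
-- demands; weakening and contraction are asked of unbounded labels only, and up to observation
-- instead of as laws of the monoid.
record PhaseModel (Σ : SubexpSignature a) (S : Signature s) : Set (lsuc (a ⊔ s)) where
  infix 4 _⊩_
  field
    states : CommutativeMonoid (a ⊔ s) (a ⊔ s)

  open CommutativeMonoid states public
    renaming (Carrier to State; refl to ≈-refl; sym to ≈-sym; trans to ≈-trans)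
  open SubexpSignature Σ using (_≼_; Unbounded)

  field
    Observation : Set (a ⊔ s)
    _⊩_         : State → Observation → Set (a ⊔ s)
    ⊩-resp-≈    : ∀ {x y o} → x ≈ y → x ⊩ o → y ⊩ o
    Atomic      : Atom S 0 → Pred State (a ⊔ s)
    Modal       : Label Σ → Pred State (a ⊔ s)
    modal-ε     : ∀ l → Modal l ε
    modal-∙     : ∀ l {x y} → Modal l x → Modal l y → Modal l (x ∙ y)
    modal-≼     : ∀ {l k x} → l ≼ k → Modal k x → Modal l x
    discard     : ∀ {l x y o} → Unbounded l → Modal l x → y ⊩ o → x ∙ y ⊩ o
    duplicate   : ∀ {l x y o} → Unbounded l → Modal l x → x ∙ (x ∙ y) ⊩ o → x ∙ y ⊩ o

module Phase {Σ : SubexpSignature a} {S : Signature s} (𝔐 : PhaseModel Σ S) where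

  open PhaseModel 𝔐
  open SubexpSignature Σ using (_≼_; Unbounded)

  -- The intersection of all sets of states `x` with `x ∙ y ⊩ o`, for fixed `y` and `o`, that
  -- contain `X`. Written in continuation-passing form it is a monad, whence `η` and `bind`.
  Cl : Pred State (a ⊔ s) → Pred State (a ⊔ s)
  Cl X x = ∀ y o → (∀ x′ → X x′ → x′ ∙ y ⊩ o) → x ∙ y ⊩ o

  IsFact : Pred State (a ⊔ s) → Set (a ⊔ s)
  IsFact X = ∀ {x} → Cl X x → X x

  η : ∀ {X x} → X x → Cl X x
  η {x = x} p y o h = h x p

  Cl-mono : ∀ {X Y : Pred State (a ⊔ s)} → (∀ {x} → X x → Y x) → ∀ {x} → Cl X x → Cl Y x
  Cl-mono f p y o h = p y o (λ x′ q → h x′ (f q))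

  Cl-fact : ∀ X → IsFact (Cl X)
  Cl-fact X p y o h = p y o (λ x′ q → q y o h)

  fact-resp-≈ : ∀ {X x y} → IsFact X → x ≈ y → X x → X y
  fact-resp-≈ {x = x} fact x≈y p = fact (λ z o h → ⊩-resp-≈ (∙-congʳ x≈y) (h x p))

  fact-shift : ∀ {X} y → IsFact X → IsFact (λ x → X (x ∙ y))
  fact-shift {X} y fact {x} p = fact (λ z o h →
    ⊩-resp-≈ (≈-sym (assoc x y z))
      (p (y ∙ z) o (λ x′ q → ⊩-resp-≈ (assoc x′ y z) (h (x′ ∙ y) q))))

  -- Residuals of facts are facts (`fact-shift`), so an element known only up to closure may be
  -- replaced by a generator while the rest `y` of the context stays in place. The left rules for
  -- `𝟏`, `⊗`, `∃` and the modalities rest on this.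
  bind : ∀ {X Y x y} → IsFact Y → Cl X x → (∀ x′ → X x′ → Y (x′ ∙ y)) → Y (x ∙ y)
  bind {y = y} fact p h = fact-shift y fact (λ z o g → p z o (λ x′ q → g x′ (h x′ q)))

  observe : ∀ {X x o} → Cl X x → (∀ x′ → X x′ → x′ ⊩ o) → x ⊩ o
  observe {x = x} p h = ⊩-resp-≈ (identityʳ x)
    (p ε _ (λ x′ q → ⊩-resp-≈ (≈-sym (identityʳ x′)) (h x′ q)))

  ⟪_⟫ : Formula (Label Σ) S n → Subst (functions S) n 0 → Pred State (a ⊔ s)
  ⟪ atom A ⟫   σ x = Cl (Atomic (subᵃ σ A)) x
  ⟪ 𝟏 ⟫        σ x = Cl (_≡ ε) x
  ⟪ ⊤ᶠ ⟫       σ x = ⊤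
  ⟪ F ⊗ G ⟫    σ x = Cl (λ x → ∃[ y ] ∃[ z ] ⟪ F ⟫ σ y × ⟪ G ⟫ σ z × x ≡ y ∙ z) x
  ⟪ F ⊸ G ⟫    σ x = ∀ y → ⟪ F ⟫ σ y → ⟪ G ⟫ σ (y ∙ x)
  ⟪ F & G ⟫    σ x = ⟪ F ⟫ σ x × ⟪ G ⟫ σ x
  ⟪ ∃ᶠ F ⟫     σ x = Cl (λ x → ∃[ t ] ⟪ F ⟫ (σ ▸ t) x) x
  ⟪ ∀ᶠ F ⟫     σ x = ∀ t → ⟪ F ⟫ (σ ▸ t) x
  ⟪ ![ l ] F ⟫ σ x = Cl (λ x → Modal l x × ⟪ F ⟫ σ x) x

  fact : (F : Formula (Label Σ) S n) (σ : Subst (functions S) n 0) → IsFact (⟪ F ⟫ σ)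
  fact (atom A)   σ p = Cl-fact _ p
  fact 𝟏          σ p = Cl-fact _ p
  fact ⊤ᶠ         σ p = _
  fact (F ⊗ G)    σ p = Cl-fact _ p
  fact (F ⊸ G)    σ {x} p y q = fact-resp-≈ (fact G σ) (comm x y)
    (bind (fact G σ) p (λ x′ r → fact-resp-≈ (fact G σ) (comm y x′) (r y q)))
  fact (F & G)    σ p = fact F σ (Cl-mono proj₁ p) , fact G σ (Cl-mono proj₂ p)
  fact (∃ᶠ F)     σ p = Cl-fact _ p
  fact (∀ᶠ F)     σ p t = fact F (σ ▸ t) (Cl-mono (λ q → q t) p)
  fact (![ l ] F) σ p = Cl-fact _ p

  resp-≈ : ∀ (F : Formula (Label Σ) S n) {σ x y} → x ≈ y → ⟪ F ⟫ σ x → ⟪ F ⟫ σ y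
  resp-≈ F = fact-resp-≈ (fact F _)

  Fused : Subst (functions S) m n → Subst (functions S) n 0 → Subst (functions S) m 0 →
          List Name → Set s
  Fused τ σ ρ xs = Agree xs (subᵗ σ ∘ τ) ρ

  fused-▸ : ∀ {τ : Subst (functions S) m n} {σ ρ xs} t → Fused τ σ ρ xs →
            Fused (liftˢ τ) (σ ▸ t) (ρ ▸ t) xs
  fused-▸ {τ = τ} {σ} t h v p = trans (▸-liftˢ σ τ t v) (▸-agree t h v p)

  mutual
    -- The two directions are mutual because `⊸` is contravariant on its left. Asking `Fused` only
    -- on the free names covers eigenvariables, and the case `τ = var` gives `coincidence`.
    sub⁺ : ∀ (F : Formula (Label Σ) S m) {τ : Subst (functions S) m n} {σ ρ} →
           Fused τ σ ρ (fvᶠ F) → ∀ {x} → ⟪ F ⟫ ρ x → ⟪ subᶠ τ F ⟫ σ x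
    sub⁺ (atom A) h {x} p =
      subst (λ A → Cl (Atomic A) x)
        (sym (trans (subᵃ-comp {L = Label Σ} A) (subᵃ-cong {L = Label Σ} A h))) p
    sub⁺ 𝟏          h p = p
    sub⁺ ⊤ᶠ         h p = p
    sub⁺ (F ⊗ G)    h p = Cl-mono (λ { (y , z , q , r , e) →
      y , z , sub⁺ F (agreeˡ h) q , sub⁺ G (agreeʳ (fvᶠ F) h) r , e }) p
    sub⁺ (F ⊸ G)    h p y q = sub⁺ G (agreeʳ (fvᶠ F) h) (p y (sub⁻ F (agreeˡ h) q))
    sub⁺ (F & G)    h (p , q) = sub⁺ F (agreeˡ h) p , sub⁺ G (agreeʳ (fvᶠ F) h) q
    sub⁺ (∃ᶠ F)     h p = Cl-mono (λ { (t , q) → t , sub⁺ F (fused-▸ t h) q }) p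
    sub⁺ (∀ᶠ F)     h p t = sub⁺ F (fused-▸ t h) (p t)
    sub⁺ (![ l ] F) h p = Cl-mono (λ { (q , r) → q , sub⁺ F h r }) p

    sub⁻ : ∀ (F : Formula (Label Σ) S m) {τ : Subst (functions S) m n} {σ ρ} →
           Fused τ σ ρ (fvᶠ F) → ∀ {x} → ⟪ subᶠ τ F ⟫ σ x → ⟪ F ⟫ ρ x
    sub⁻ (atom A) h {x} p =
      subst (λ A → Cl (Atomic A) x)
        (trans (subᵃ-comp {L = Label Σ} A) (subᵃ-cong {L = Label Σ} A h)) p
    sub⁻ 𝟏          h p = p
    sub⁻ ⊤ᶠ         h p = p
    sub⁻ (F ⊗ G)    h p = Cl-mono (λ { (y , z , q , r , e) →
      y , z , sub⁻ F (agreeˡ h) q , sub⁻ G (agreeʳ (fvᶠ F) h) r , e }) p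
    sub⁻ (F ⊸ G)    h p y q = sub⁻ G (agreeʳ (fvᶠ F) h) (p y (sub⁺ F (agreeˡ h) q))
    sub⁻ (F & G)    h (p , q) = sub⁻ F (agreeˡ h) p , sub⁻ G (agreeʳ (fvᶠ F) h) q
    sub⁻ (∃ᶠ F)     h p = Cl-mono (λ { (t , q) → t , sub⁻ F (fused-▸ t h) q }) p
    sub⁻ (∀ᶠ F)     h p t = sub⁻ F (fused-▸ t h) (p t)
    sub⁻ (![ l ] F) h p = Cl-mono (λ { (q , r) → q , sub⁻ F h r }) p

  coincidence : ∀ (F : Formula (Label Σ) S n) {σ ρ} → Agree (fvᶠ F) σ ρ →
                ∀ {x} → ⟪ F ⟫ σ x → ⟪ F ⟫ ρ x
  coincidence F {σ} h {x} p =
    sub⁻ F {τ = var} h (subst (λ F → ⟪ F ⟫ σ x) (sym (subᶠ-var F)) p)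

  Elements : Subst (functions S) 0 0 → List (Formula (Label Σ) S 0) → Set (a ⊔ s)
  Elements σ = All (λ F → ∃ (⟪ F ⟫ σ))

  total : ∀ {σ Γ} → Elements σ Γ → State
  total []             = ε
  total ((x , _) ∷ xs) = x ∙ total xs

  private
    module Solver = CommutativeMonoidSolver states
  open Solver using (solve; _⊜_; _⊕_)

  permute : ∀ {σ Γ Γ′} → Γ ↭ Γ′ → (xs : Elements σ Γ′) → Σ[ ys ∈ Elements σ Γ ] total ys ≈ total xs
  permute ↭.refl       xs               = xs , ≈-refl
  permute (↭.prep F p) (x ∷ xs)         = let ys , e = permute p xs in x ∷ ys , ∙-congˡ e
  permute (↭.swap F G p) (x@(u , _) ∷ y@(v , _) ∷ xs) = let ys , e = permute p xs in
    y ∷ x ∷ ys , ≈-trans (solve 3 (λ u v w → v ⊕ u ⊕ w ⊜ u ⊕ v ⊕ w) ≈-refl u v (total ys))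
                         (∙-congˡ (∙-congˡ e))
  permute (↭.trans p q) xs               =
    let ys , e = permute q xs
        zs , e′ = permute p ys
    in zs , ≈-trans e′ e

  split : ∀ {σ} Γ {Γ′} (xs : Elements σ (Γ ++ Γ′)) →
          Σ[ ys ∈ Elements σ Γ ] Σ[ zs ∈ Elements σ Γ′ ] total ys ∙ total zs ≈ total xs
  split []      xs             = [] , xs , identityˡ _
  split (F ∷ Γ) (x@(u , _) ∷ xs) =
    let ys , zs , e = split Γ xs in x ∷ ys , zs , ≈-trans (assoc u _ _) (∙-congˡ e)

  transfer : ∀ {σ ρ} Γ → Agree (concatMap fvᶠ Γ) σ ρ → (xs : Elements σ Γ) →
             Σ[ ys ∈ Elements ρ Γ ] total ys ≡ total xs
  transfer []      h []             = [] , refl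
  transfer (F ∷ Γ) h ((x , p) ∷ xs) =
    let ys , e = transfer Γ (agreeʳ (fvᶠ F) h) xs
    in (x , coincidence F (agreeˡ h) p) ∷ ys , cong (x ∙_) e

  -- A boxed hypothesis supplies only the closure of its modal elements, whereas promotion needs all
  -- hypotheses modal at once. They are replaced one at a time, those already replaced being
  -- absorbed into the fact `Y`; `modal-≼` lowers each label to `l`.
  unbox : ∀ {σ l Γ} {Y : Pred State (a ⊔ s)} → Boxed Σ l Γ → IsFact Y → (xs : Elements σ Γ) →
          ((ys : Elements σ Γ) → Modal l (total ys) → Y (total ys)) → Y (total xs)
  unbox []                              Y-fact []             h = h [] (modal-ε _)
  unbox {Y = Y} ((k , F , refl , l≼k) ∷ bs) Y-fact ((x , p) ∷ xs) h =
    bind Y-fact p λ x′ q →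
      fact-resp-≈ Y-fact (comm _ _)
        (unbox {Y = λ z → Y (z ∙ x′)} bs (fact-shift x′ Y-fact) xs λ ys r →
          fact-resp-≈ Y-fact (comm _ _)
            (h ((x′ , η q) ∷ ys) (modal-∙ _ (modal-≼ l≼k (proj₁ q)) r)))

  update : Name → Term (functions S) 0 → Subst (functions S) 0 0 → Subst (functions S) 0 0
  update x t σ (free y) with x ≡ᵇ y
  ... | true  = t
  ... | false = σ (free y)

  update-same : ∀ x t σ → update x t σ (free x) ≡ t
  update-same x t σ with x ≡ᵇ x | ℕ.≡⇒≡ᵇ x x refl
  ... | true | _ = refl

  update-agree : ∀ {x t σ xs} → x ∉ xs → Agree xs σ (update x t σ)
  update-agree {x} x∉ (free y) y⊆ with x ≡ᵇ y | ℕ.≡ᵇ⇒≡ x y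
  ... | true  | e = contradiction (y⊆ (here (e tt))) x∉
  ... | false | _ = refl

  -- A fresh name can be given any value, so it is given the value `t` of the bound variable. This
  -- turns a premise about one eigenvariable into a statement about all `t`.
  fused-eigen : ∀ {x t σ xs} → x ∉ xs →
                Fused (instantiate (var (free x))) (update x t σ) (σ ▸ t) xs
  fused-eigen {x} {t} {σ} x∉ (bound zero) p = update-same x t σ
  fused-eigen x∉ (free y)     p = sym (update-agree x∉ (free y) p)

  fused-instantiate : ∀ {t : Term (functions S) 0} {σ xs} →
                      Fused (instantiate t) σ (σ ▸ subᵗ σ t) xs
  fused-instantiate (bound zero) p = refl
  fused-instantiate (free y)     p = refl

  sound : ∀ {Γ G} → Σ ∣ Γ ⟶ G → ∀ σ (xs : Elements σ Γ) → ⟪ G ⟫ σ (total xs)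
  sound {G = G} (exch p d) σ xs = let ys , e = permute p xs in resp-≈ G e (sound d σ ys)
  sound {G = G} init σ ((x , p) ∷ []) = resp-≈ G (≈-sym (identityʳ x)) p
  sound 𝟏R σ [] = η refl
  sound {G = G} (𝟏L d) σ ((x , p) ∷ xs) = bind (fact G σ) p λ { _ refl →
    resp-≈ G (≈-sym (identityˡ _)) (sound d σ xs) }
  sound ⊤R σ xs = _
  sound {G = F ⊗ G} (⊗R {Γ = Γ} d e) σ xs =
    let ys , zs , eq = split Γ xs
    in resp-≈ (F ⊗ G) eq (η (total ys , total zs , sound d σ ys , sound e σ zs , refl))
  sound {G = H} (⊗L d) σ ((x , p) ∷ xs) = bind (fact H σ) p λ { _ (y , z , q , r , refl) →
    resp-≈ H (≈-sym (assoc y z _)) (sound d σ ((y , q) ∷ (z , r) ∷ xs)) }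
  sound (⊸R d) σ xs y p = sound d σ ((y , p) ∷ xs)
  sound {G = H} (⊸L {Γ = Γ} d e) σ ((x , p) ∷ xs) =
    let ys , zs , eq = split Γ xs
    in resp-≈ H
         (≈-trans (solve 3 (λ y x z → (y ⊕ x) ⊕ z ⊜ x ⊕ y ⊕ z) ≈-refl (total ys) x (total zs))
                  (∙-congˡ eq))
         (sound e σ ((total ys ∙ x , p (total ys) (sound d σ ys)) ∷ zs))
  sound (&R d e) σ xs = sound d σ xs , sound e σ xs
  sound (&L₁ d) σ ((x , p , _) ∷ xs) = sound d σ ((x , p) ∷ xs)
  sound (&L₂ d) σ ((x , _ , q) ∷ xs) = sound d σ ((x , q) ∷ xs)
  sound (∃R {F = F} t d) σ xs = η (subᵗ σ t , sub⁻ F fused-instantiate (sound d σ xs))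
  -- The premise is interpreted with `x` evaluated to the witness `t`; freshness carries the context
  -- into that environment and the conclusion back out of it.
  sound (∃L {Γ} {F} {G} x x∉ d) σ ((y , p) ∷ xs) = bind (fact G σ) p λ { y′ (t , q) →
    let ys , e = transfer Γ (update-agree (x∉ ∘ ∈-++⁺ʳ (fvᶠ F) ∘ ∈-++⁺ʳ (fvᶠ G))) xs in
    coincidence G (λ v v⊆ → sym (update-agree (x∉ ∘ ∈-++⁺ʳ (fvᶠ F) ∘ ∈-++⁺ˡ) v v⊆))
      (subst (⟪ G ⟫ _) (cong (y′ ∙_) e)
        (sound d (update x t σ) ((y′ , sub⁺ F (fused-eigen (x∉ ∘ ∈-++⁺ˡ)) q) ∷ ys))) }
  sound (∀R {Γ} {F} x x∉ d) σ xs t =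
    let ys , e = transfer Γ (update-agree (x∉ ∘ ∈-++⁺ʳ (fvᶠ F))) xs in
    sub⁻ F (fused-eigen (x∉ ∘ ∈-++⁺ˡ))
      (subst (⟪ subᶠ (instantiate (var (free x))) F ⟫ (update x t σ)) e (sound d (update x t σ) ys))
  sound (∀L {F = F} t d) σ ((x , p) ∷ xs) =
    sound d σ ((x , sub⁺ F fused-instantiate (p (subᵗ σ t))) ∷ xs)
  sound {G = G} (dereliction d) σ ((x , p) ∷ xs) = bind (fact G σ) p λ { x′ (_ , q) →
    sound d σ ((x′ , q) ∷ xs) }
  sound {G = ![ l ] F} (promotion bs d) σ xs =
    unbox bs (Cl-fact _) xs λ ys q → η (q , sound d σ ys)
  sound {G = G} (weakening u d) σ ((x , p) ∷ xs) = bind (fact G σ) p λ { x′ (q , _) →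
    fact G σ λ y o h → ⊩-resp-≈ (≈-sym (assoc _ _ _)) (discard u q (h _ (sound d σ xs))) }
  sound {G = G} (contraction u d) σ ((x , p) ∷ xs) = bind (fact G σ) p λ { x′ (q , r) →
    fact G σ λ y o h → ⊩-resp-≈ (≈-sym (assoc _ _ _)) (duplicate u q
      (⊩-resp-≈ (≈-trans (assoc _ _ _) (∙-congˡ (assoc _ _ _)))
        (h _ (sound d σ ((x′ , η (q , r)) ∷ (x′ , η (q , r)) ∷ xs))))) }

-- Admissibility of cut

module ↭-Solver {a} {A : Set a} = CommutativeMonoidSolver (++-commutativeMonoid {A = A})
open ↭-Solver using (solve; _⊜_; _⊕_)

fresh : List Name → Name
fresh xs = suc (sum xs)

fresh∉ : ∀ xs → fresh xs ∉ xs
fresh∉ xs x∈ = ℕ.1+n≰n (≤-sum x∈)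
  where
  ≤-sum : ∀ {x xs} → x ∈ xs → x ℕ.≤ sum xs
  ≤-sum (here refl) = ℕ.m≤m+n _ _
  ≤-sum (there x∈)  = ℕ.≤-trans (≤-sum x∈) (ℕ.m≤n+m _ _)

module CutAdmissibility {Σ : SubexpSignature a} {S : Signature s} where

  open SubexpSignature Σ using (_≼_; Unbounded; isPreorder; unbounded-upward)
  open IsPreorder isPreorder using () renaming (reflexive to ≼-reflexive; trans to ≼-trans)

  private
    Fm : ℕ → Set (a ⊔ s)
    Fm = Formula (Label Σ) S

  -- Stated as closure of provability, since the canonical model needs it before
  -- cut is available.
  Structural : Fm 0 → Set (a ⊔ s)
  Structural F = (∀ {Γ G} → Σ ∣ Γ ⟶ G → Σ ∣ F ∷ Γ ⟶ G)
               × (∀ {Γ G} → Σ ∣ F ∷ F ∷ Γ ⟶ G → Σ ∣ F ∷ Γ ⟶ G)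

  box-structural : ∀ {l F} → Unbounded l → Structural (![ l ] F)
  box-structural u = weakening u , contraction u

  boxes-structural : ∀ {l Γ} → Unbounded l → Boxed Σ l Γ → All Structural Γ
  boxes-structural u = All.map λ { (k , F , refl , l≼k) → box-structural (unbounded-upward l≼k u) }

  discards : ∀ {Γ Δ G} → All Structural Γ → Σ ∣ Δ ⟶ G → Σ ∣ Γ ++ Δ ⟶ G
  discards []             d = d
  discards ((w , _) ∷ fs) d = w (discards fs d)

  duplicates : ∀ {Γ Δ G} → All Structural Γ → Σ ∣ Γ ++ (Γ ++ Δ) ⟶ G → Σ ∣ Γ ++ Δ ⟶ G
  duplicates                  []             d = d
  duplicates {Γ = F ∷ Γ} {Δ} ((_ , c) ∷ fs) d =
    c (exch (solve 3 (λ f g d → g ⊕ f ⊕ f ⊕ d ⊜ f ⊕ f ⊕ g ⊕ d) ↭-refl [ F ] Γ Δ)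
        (duplicates fs
          (exch (solve 3 (λ f g d → (f ⊕ g) ⊕ (f ⊕ g) ⊕ d ⊜ g ⊕ g ⊕ f ⊕ f ⊕ d) ↭-refl
                         [ F ] Γ Δ) d)))

  -- The closure of an atom's singleton context consists of the contexts that may replace the atom
  -- on the left of any provable sequent, so cuts on atoms are built in. `discard` and `duplicate`
  -- rest on the upward closure of `Unbounded`, which makes every formula of a boxed context
  -- structural.
  canonical : PhaseModel Σ S
  canonical = record
    { states      = ++-commutativeMonoid {A = Fm 0}
    ; Observation = Fm 0
    ; _⊩_         = Σ ∣_⟶_
    ; ⊩-resp-≈    = exch
    ; Atomic      = λ A Γ → Γ ≡ [ atom A ]
    ; Modal       = Boxed Σ
    ; modal-ε     = λ l → []
    ; modal-∙     = λ l → All.++⁺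
    ; modal-≼     = λ l≼k → All.map λ { (j , F , e , k≼j) → j , F , e , ≼-trans l≼k k≼j }
    ; discard     = λ u bs → discards (boxes-structural u bs)
    ; duplicate   = λ u bs → duplicates (boxes-structural u bs)
    }

  open Phase canonical

  mutual
    -- Okada's lemma, in two halves: left rules prove `reflect`, right rules prove `reify`, and
    -- `init` enters only at atoms. Implication exchanges the halves, hence the mutual recursion.
    reflect : ∀ (F : Fm n) σ → ⟪ F ⟫ σ [ subᶠ σ F ]
    reflect (atom A)   σ = η refl
    reflect 𝟏          σ Δ o h = 𝟏L (h [] refl)
    reflect ⊤ᶠ         σ = _
    reflect (F ⊗ G)    σ Δ o h = ⊗L (h _ (_ , _ , reflect F σ , reflect G σ , refl))
    reflect (F ⊸ G)    σ Γ p = fact G σ λ Δ o h →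
      exch (solve 3 (λ f g d → f ⊕ g ⊕ d ⊜ (g ⊕ f) ⊕ d) ↭-refl [ subᶠ σ (F ⊸ G) ] Γ Δ)
        (⊸L (reify F σ p) (h _ (reflect G σ)))
    reflect (F & G)    σ = fact F σ (λ Δ o h → &L₁ (h _ (reflect F σ)))
                         , fact G σ (λ Δ o h → &L₂ (h _ (reflect G σ)))
    reflect (∃ᶠ F)     σ Δ o h = let xs = concatMap fvᶠ (subᶠ σ (∃ᶠ F) ∷ o ∷ Δ) ; x = fresh xs in
      ∃L x (fresh∉ xs)
        (subst (λ F → Σ ∣ F ∷ Δ ⟶ o) (sym (open-lift σ (var (free x)) F))
          (h _ (var (free x) , reflect F _)))
    reflect (∀ᶠ F)     σ t = fact F (σ ▸ t) λ Δ o h →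
      ∀L t (subst (λ F → Σ ∣ F ∷ Δ ⟶ o) (sym (open-lift σ t F)) (h _ (reflect F _)))
    reflect (![ l ] F) σ = η ( (l , _ , refl , ≼-reflexive refl) ∷ []
                             , fact F σ (λ Δ o h → dereliction (h _ (reflect F σ))))

    reify : ∀ (F : Fm n) σ {Γ} → ⟪ F ⟫ σ Γ → Σ ∣ Γ ⟶ subᶠ σ F
    reify (atom A)   σ p = observe p λ { _ refl → init }
    reify 𝟏          σ p = observe p λ { _ refl → 𝟏R }
    reify ⊤ᶠ         σ p = ⊤R
    reify (F ⊗ G)    σ p = observe p λ { _ (Γ , Δ , q , r , refl) → ⊗R (reify F σ q) (reify G σ r) }
    reify (F ⊸ G)    σ p = ⊸R (reify G σ (p _ (reflect F σ)))
    reify (F & G)    σ (p , q) = &R (reify F σ p) (reify G σ q)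
    reify (∃ᶠ F)     σ p = observe p λ { Γ (t , q) →
      ∃R t (subst (Σ ∣ Γ ⟶_) (sym (open-lift σ t F)) (reify F _ q)) }
    reify (∀ᶠ F)     σ {Γ} p = let xs = concatMap fvᶠ (subᶠ σ (∀ᶠ F) ∷ Γ) ; x = fresh xs in
      ∀R x (fresh∉ xs)
        (subst (Σ ∣ Γ ⟶_) (sym (open-lift σ (var (free x)) F)) (reify F _ (p _)))
    reify (![ l ] F) σ p = observe p λ { Γ (bs , q) → promotion bs (reify F σ q) }

  elements : ∀ Γ → Σ-syntax (Elements var Γ) λ xs → total xs ≡ Γ
  elements []      = [] , refl
  elements (F ∷ Γ) = let xs , e = elements Γ in
    ([ F ] , subst (λ G → ⟪ F ⟫ var [ G ]) (subᶠ-var F) (reflect F var)) ∷ xs , cong (F ∷_) e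

  -- Soundness of `d` puts `Γ` into the denotation of `A`; soundness of `e` then puts `Γ ++ Δ` into
  -- that of `C`, from which `reify` reads off a derivation.
  cut : ∀ {Γ Δ A C} → Σ ∣ Γ ⟶ A → Σ ∣ A ∷ Δ ⟶ C → Σ ∣ Γ ++ Δ ⟶ C
  cut {Γ} {Δ} {A} {C} d e =
    let xs , p = elements Γ
        ys , q = elements Δ
    in subst₂ (Σ ∣_⟶_) (cong₂ _++_ p q) (subᶠ-var C)
         (reify C var (sound e var ((total xs , sound d var xs) ∷ ys)))

  use : ∀ {H Γ Δ G} → All Structural Γ → H ∈ Γ → Σ ∣ H ∷ Δ ++ Γ ⟶ G → Σ ∣ Δ ++ Γ ⟶ G
  use {H} {Γ} {Δ} fs H∈Γ d with All.lookup fs H∈Γ | ∈-∃++ H∈Γ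
  ... | _ , c | Γ₁ , Γ₂ , refl =
    exch (solve 4 (λ h d x y → h ⊕ d ⊕ x ⊕ y ⊜ d ⊕ x ⊕ h ⊕ y) ↭-refl [ H ] Δ Γ₁ Γ₂)
      (c (exch (solve 4 (λ h d x y → h ⊕ d ⊕ x ⊕ h ⊕ y ⊜ h ⊕ h ⊕ d ⊕ x ⊕ y) ↭-refl
                        [ H ] Δ Γ₁ Γ₂) d))

  ∀⋆L : ∀ {Γ G} (F : Fm n) (σ : Subst (functions S) n 0) → (∀ x → σ (free x) ≡ var (free x)) →
        Σ ∣ subᶠ σ F ∷ Γ ⟶ G → Σ ∣ ∀⋆ F ∷ Γ ⟶ G
  ∀⋆L {n = zero}  {Γ} {G} F σ h d =
    subst (λ F → Σ ∣ F ∷ Γ ⟶ G) (subᶠ-id F λ { (free x) → h x }) d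
  ∀⋆L {n = suc n} {Γ} {G} F σ h d =
    -- Index zero belongs to the innermost quantifier: `σ′` instantiates the outer ones by
    -- recursion, and one `∀L` remains.
    ∀⋆L (∀ᶠ F) σ′ h (∀L (σ (bound zero))
      (subst (λ F → Σ ∣ F ∷ Γ ⟶ G)
        (trans (subᶠ-cong F (agree σ-split)) (sym (open-lift σ′ (σ (bound zero)) F))) d))
    where
    σ′ : Subst (functions S) n 0
    σ′ (bound i) = σ (bound (suc i))
    σ′ (free x)  = σ (free x)
    σ-split : σ ≗ σ′ ▸ σ (bound zero)
    σ-split (bound zero)    = refl
    σ-split (bound (suc i)) = refl
    σ-split (free x)        = refl

  -- Weakening and contraction of constraints

  module _ {A : Set b} {S₀ : Signature s} (label : A → Label Σ)
           (unbounded : ∀ l → Unbounded (label l))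
           (atomᴱ : ∀ {n} → Atom S₀ n → Atom S n) where

    open Embedding {S = S₀} {S′ = S} label atomᴱ

    eraseᶜ : (c : Constraint A S₀ n) (σ : Subst (functions S) n 0) → Σ ∣ [ subᶠ σ (formula c) ] ⟶ 𝟏
    eraseᶜ 𝟏            σ = init
    eraseᶜ (c ⊗ d)      σ = ⊗L (cut (eraseᶜ c σ) (𝟏L (eraseᶜ d σ)))
    eraseᶜ (∃ᶜ c)       σ = let xs = concatMap fvᶠ (subᶠ σ (∃ᶠ (formula c)) ∷ 𝟏 ∷ [])
                                x  = fresh xs in
      ∃L x (fresh∉ xs)
        (subst (λ F → Σ ∣ [ F ] ⟶ 𝟏) (sym (open-lift σ (var (free x)) (formula c))) (eraseᶜ c _))
    eraseᶜ (![ l ] B)   σ = weakening (unbounded l) 𝟏R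
    eraseᶜ (![ l ]⨂ Bs) σ = weakening (unbounded l) 𝟏R

    copyᶜ : (c : Constraint A S₀ n) (σ : Subst (functions S) n 0) →
            Σ ∣ [ subᶠ σ (formula c) ] ⟶ subᶠ σ (formula c) ⊗ subᶠ σ (formula c)
    copyᶜ 𝟏            σ = 𝟏L (⊗R 𝟏R 𝟏R)
    copyᶜ (c ⊗ d)      σ =
      let F = subᶠ σ (formula c) ; G = subᶠ σ (formula d) in
      ⊗L (cut (copyᶜ c σ) (⊗L
        (exch (solve 2 (λ f g → g ⊕ f ⊕ f ⊜ f ⊕ f ⊕ g) ↭-refl [ F ] [ G ])
          (cut (copyᶜ d σ) (⊗L
            (exch (solve 2 (λ f g → (f ⊕ g) ⊕ (f ⊕ g) ⊜ g ⊕ g ⊕ f ⊕ f) ↭-refl [ F ] [ G ])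
              (⊗R (⊗R init init) (⊗R init init))))))))
    copyᶜ (∃ᶜ c)       σ = let F = subᶠ σ (∃ᶠ (formula c))
                               xs = concatMap fvᶠ (F ∷ F ⊗ F ∷ []) ; x = fresh xs
                               e = open-lift σ (var (free x)) (formula c) in
      ∃L x (fresh∉ xs)
        (cut (subst (λ H → Σ ∣ [ H ] ⟶ H ⊗ H) (sym e) (copyᶜ c _))
             (⊗L (⊗R (∃R (var (free x)) init) (∃R (var (free x)) init))))
    copyᶜ (![ l ] B)   σ = contraction (unbounded l) (⊗R init init)
    copyᶜ (![ l ]⨂ Bs) σ = contraction (unbounded l) (⊗R init init)

    -- An `ask` only consults the store, while a linear sequent would consume it. Cutting against
    -- `c ⟶ 𝟏` and `c ⟶ c ⊗ c` makes the store persistent even where it is not a box.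
    constraint-structural : (c : Constraint A S₀ 0) → Structural (formula c)
    constraint-structural c =
        (λ d → cut (subst (λ F → Σ ∣ [ F ] ⟶ 𝟏) (subᶠ-var (formula c)) (eraseᶜ c var)) (𝟏L d))
      , (λ d → cut (subst (λ F → Σ ∣ [ F ] ⟶ F ⊗ F) (subᶠ-var (formula c)) (copyᶜ c var)) (⊗L d))

-- From executions to proofs

module Embed {a s} (𝒞 : SoftConstraintSystem a s)
             (Ψ : Definitions (SoftConstraintSystem.Carrier 𝒞)
                              (SoftConstraintSystem.signature 𝒞)) where

  open SoftConstraintSystem 𝒞
  open Encoding 𝒞 Ψ
  open ExtSignature semiring using (‵⊑‵; unb-‵)
  open EncodingProperties 𝒞 Ψ

  Form₀ : ℕ → Set (a ⊔ s)
  Form₀ = Formula Carrier signature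

  -- Defined on all formulas and not just on constraints, because `embed-proof` recurses over
  -- derivations; the axioms alone already bring in `⊸` and `∀`.
  embed : Form₀ n → Form n
  embed (atom A)   = atom (inclusion A)
  embed 𝟏          = 𝟏
  embed ⊤ᶠ         = ⊤ᶠ
  embed (F ⊗ G)    = embed F ⊗ embed G
  embed (F ⊸ G)    = embed F ⊸ embed G
  embed (F & G)    = embed F & embed G
  embed (∃ᶠ F)     = ∃ᶠ (embed F)
  embed (∀ᶠ F)     = ∀ᶠ (embed F)
  embed (![ l ] F) = ![ ‵ l ] embed F

  embed-sub : (σ : Subst (functions signature) m n) (F : Form₀ m) →
              embed (subᶠ σ F) ≡ subᶠ σ (embed F)
  embed-sub σ (atom (p · ts)) = refl
  embed-sub σ 𝟏          = refl
  embed-sub σ ⊤ᶠ         = refl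
  embed-sub σ (F ⊗ G)    = cong₂ _⊗_ (embed-sub σ F) (embed-sub σ G)
  embed-sub σ (F ⊸ G)    = cong₂ _⊸_ (embed-sub σ F) (embed-sub σ G)
  embed-sub σ (F & G)    = cong₂ _&_ (embed-sub σ F) (embed-sub σ G)
  embed-sub σ (∃ᶠ F)     = cong ∃ᶠ (embed-sub (liftˢ σ) F)
  embed-sub σ (∀ᶠ F)     = cong ∀ᶠ (embed-sub (liftˢ σ) F)
  embed-sub σ (![ l ] F) = cong (![ ‵ l ]_) (embed-sub σ F)

  embed-fv : (F : Form₀ n) → fvᶠ (embed F) ≡ fvᶠ F
  embed-fv (atom (p · ts)) = refl
  embed-fv 𝟏          = refl
  embed-fv ⊤ᶠ         = refl
  embed-fv (F ⊗ G)    = cong₂ _++_ (embed-fv F) (embed-fv G)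
  embed-fv (F ⊸ G)    = cong₂ _++_ (embed-fv F) (embed-fv G)
  embed-fv (F & G)    = cong₂ _++_ (embed-fv F) (embed-fv G)
  embed-fv (∃ᶠ F)     = embed-fv F
  embed-fv (∀ᶠ F)     = embed-fv F
  embed-fv (![ l ] F) = embed-fv F

  embed-fvs : (Γ : List (Form₀ 0)) → concatMap fvᶠ (List.map embed Γ) ≡ concatMap fvᶠ Γ
  embed-fvs []      = refl
  embed-fvs (F ∷ Γ) = cong₂ _++_ (embed-fv F) (embed-fvs Γ)

  embed-proof : ∀ {Γ G} → Σ₀ ∣ Γ ⟶ G → Σᴱ ∣ List.map embed Γ ⟶ embed G
  embed-proof (exch p d) = exch (map⁺ embed p) (embed-proof d)
  embed-proof init = init
  embed-proof 𝟏R = 𝟏R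
  embed-proof (𝟏L d) = 𝟏L (embed-proof d)
  embed-proof ⊤R = ⊤R
  embed-proof {G = F ⊗ G} (⊗R {Γ} {Γ′} d e) =
    subst (Σᴱ ∣_⟶ embed (F ⊗ G)) (sym (List.map-++ embed Γ Γ′)) (⊗R (embed-proof d) (embed-proof e))
  embed-proof (⊗L d) = ⊗L (embed-proof d)
  embed-proof (⊸R d) = ⊸R (embed-proof d)
  embed-proof {G = H} (⊸L {Γ} {Γ′} {F} {G} d e) =
    subst (λ Γ → Σᴱ ∣ embed (F ⊸ G) ∷ Γ ⟶ embed H) (sym (List.map-++ embed Γ Γ′))
      (⊸L (embed-proof d) (embed-proof e))
  embed-proof (&R d e) = &R (embed-proof d) (embed-proof e)
  embed-proof (&L₁ d) = &L₁ (embed-proof d)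
  embed-proof (&L₂ d) = &L₂ (embed-proof d)
  embed-proof {Γ} (∃R {F = F} t d) =
    ∃R t (subst (Σᴱ ∣ List.map embed Γ ⟶_) (embed-sub (instantiate t) F) (embed-proof d))
  embed-proof (∃L {Γ} {F} {G} x x∉ d) =
    ∃L x (x∉ ∘ subst (x ∈_) (embed-fvs (∃ᶠ F ∷ G ∷ Γ)))
      (subst (λ F → Σᴱ ∣ F ∷ List.map embed Γ ⟶ embed G) (embed-sub _ F) (embed-proof d))
  embed-proof (∀R {Γ} {F} x x∉ d) =
    ∀R x (x∉ ∘ subst (x ∈_) (embed-fvs (∀ᶠ F ∷ Γ)))
      (subst (Σᴱ ∣ List.map embed Γ ⟶_) (embed-sub _ F) (embed-proof d))
  embed-proof (∀L {Γ} {F} {G} t d) =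
    ∀L t (subst (λ F → Σᴱ ∣ F ∷ List.map embed Γ ⟶ embed G) (embed-sub _ F) (embed-proof d))
  embed-proof (dereliction d) = dereliction (embed-proof d)
  embed-proof (promotion bs d) =
    promotion (All.map⁺ (All.map (λ { (k , F , refl , l≤k) → ‵ k , embed F , refl , ‵⊑‵ l≤k }) bs))
      (embed-proof d)
  embed-proof (weakening _ d) = weakening unb-‵ (embed-proof d)
  embed-proof (contraction _ d) = contraction unb-‵ (embed-proof d)

  embed-formula : (c : Con n) → embed (E₀.formula c) ≡ ⟦ c ⟧ᶜ
  embed-formula 𝟏          = refl
  embed-formula (c ⊗ d)    = cong₂ _⊗_ (embed-formula c) (embed-formula d)
  embed-formula (∃ᶜ c)     = cong ∃ᶠ (embed-formula c)
  embed-formula (![ l ] A) = refl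
  embed-formula {n} (![ l ]⨂ (A ∷ As)) = cong (![ ‵ l ]_) (go A As)
    where
    go : ∀ A As → embed (List⁺.foldr₁ _⊗_ (List⁺.map (λ A → ![ l ] atom A) (A ∷ As)))
                    ≡ List⁺.foldr₁ _⊗_ (List⁺.map (λ A → ![ ‵ l ] atom (inclusion A)) (A ∷ As))
    go A []        = refl
    go A (A′ ∷ As) = cong (_ ⊗_) (go A′ As)

  embed-∀⋆ : (F : Form₀ n) → embed (∀⋆ F) ≡ ∀⋆ (embed F)
  embed-∀⋆ {zero}  F = refl
  embed-∀⋆ {suc n} F = embed-∀⋆ (∀ᶠ F)

  embed-axiom : ∀ δ → embed (E₀.axiomFormula δ) ≡ Eᴱ.axiomFormula δ
  embed-axiom δ = trans (embed-∀⋆ (E₀.formula antecedent ⊸ E₀.formula consequent))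
    (cong ∀⋆ (cong₂ _⊸_ (embed-formula antecedent) (embed-formula consequent)))
    where open Axiom δ

  ⟦Δ⟧₀ : List (Form₀ 0)
  ⟦Δ⟧₀ = List.map (λ δ → ![ ⊤A ] E₀.axiomFormula δ) axioms

  embed-⊢ : ∀ {c d} → d ⊢ c → Σᴱ ∣ ⟦Δ⟧ ++ [ ⟦ d ⟧ᶜ ] ⟶ ⟦ c ⟧ᶜ
  embed-⊢ {c} {d} p = subst₂ (Σᴱ ∣_⟶_)
    (trans (List.map-++ embed ⟦Δ⟧₀ [ E₀.formula d ])
           (cong₂ _++_ (trans (sym (List.map-∘ axioms))
                              (List.map-cong (λ δ → cong (![ ‵ ⊤A ]_) (embed-axiom δ)) axioms))
                       (cong [_] (embed-formula d))))
    (embed-formula c)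
    (embed-proof p)

-- Transitions read backwards as derivations

module Adequacy⇒ {a s} (𝒞 : SoftConstraintSystem a s)
                 (Ψ : Definitions (SoftConstraintSystem.Carrier 𝒞)
                                  (SoftConstraintSystem.signature 𝒞)) where

  open SoftConstraintSystem 𝒞
  open Definitions Ψ
  open Semantics 𝒞 Ψ
  open Encoding 𝒞 Ψ
  open ExtSignature semiring using (𝔭⊑𝔭; unb-‵; unb-𝔲)
  open EncodingProperties 𝒞 Ψ
  open Embed 𝒞 Ψ using (embed-⊢)
  open CutAdmissibility {Σ = Σᴱ} {S = signatureᴱ}

  theory : List (Form 0)
  theory = ⟦Δ⟧ ++ ⟦Ψ⟧

  Δ-structural : All Structural ⟦Δ⟧
  Δ-structural = All.map⁺ (All.tabulate λ _ → box-structural unb-‵)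

  Ψ-structural : All Structural ⟦Ψ⟧
  Ψ-structural = All.map⁺ (All.tabulate λ _ → box-structural unb-𝔲)

  theory-structural : All Structural theory
  theory-structural = All.++⁺ Δ-structural Ψ-structural

  theory-closed : ∀ {x} → x ∉ concatMap fvᶠ theory
  theory-closed x∈ with ∈-concatMap⁻ fvᶠ {theory} x∈
  ... | any with find any
  ... | F , F∈ , x∈F with ∈-++⁻ ⟦Δ⟧ F∈
  ... | inj₁ F∈Δ with ∈-map⁻ (λ δ → ![ ‵ ⊤A ] Eᴱ.axiomFormula δ) F∈Δ
  ...   | δ , _ , refl = contradiction (Eᴱ.axiomFormula-closed δ x∈F) λ ()
  theory-closed x∈ | any | F , F∈ , x∈F | inj₂ F∈Ψ with ∈-map⁻ ⟦_⟧ᴰ F∈Ψ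
  ...   | p , _ , refl = contradiction (⟦⟧ᴰ-closed p x∈F) λ ()

  infix 2 _⊨_
  _⊨_ : List (Form 0) → Form 0 → Set (a ⊔ s)
  Γ ⊨ G = Σᴱ ∣ Γ ++ theory ⟶ G

  ⊨-exch : ∀ {Γ Γ′ G} → Γ ↭ Γ′ → Γ ⊨ G → Γ′ ⊨ G
  ⊨-exch p = exch (++⁺ʳ theory p)

  ⊨-contract : ∀ {Γ G} → Σᴱ ∣ Γ ++ theory ++ theory ⟶ G → Γ ⊨ G
  ⊨-contract {Γ} d = exch (++-comm theory Γ) (duplicates theory-structural
    (exch (solve 2 (λ g t → g ⊕ t ⊕ t ⊜ t ⊕ t ⊕ g) ↭-refl Γ theory) d))

  ⊨-cut : ∀ {Γ Δ A C} → Γ ⊨ A → A ∷ Δ ⊨ C → Γ ++ Δ ⊨ C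
  ⊨-cut {Γ} {Δ} d e = ⊨-contract {Γ ++ Δ}
    (exch (solve 3 (λ g d t → (g ⊕ t) ⊕ d ⊕ t ⊜ (g ⊕ d) ⊕ t ⊕ t) ↭-refl Γ Δ theory) (cut d e))

  ⊢⇒⊨ : ∀ {c d} → d ⊢ c → [ ⟦ d ⟧ᶜ ] ⊨ ⟦ c ⟧ᶜ
  ⊢⇒⊨ {d = d} p =
    exch (solve 3 (λ x y z → z ⊕ x ⊕ y ⊜ y ⊕ x ⊕ z) ↭-refl ⟦Δ⟧ [ ⟦ d ⟧ᶜ ] ⟦Ψ⟧)
      (discards Ψ-structural (embed-⊢ p))

  branch-L : ∀ {c P Γ G} c₀ P₀ bs → (c , P) ∈ (c₀ , P₀) ∷ bs →
             Σᴱ ∣ ⟦ c ⟧ᶜ ⊸ ⟦ P ⟧ᴾ ∷ Γ ⟶ G → Σᴱ ∣ branches c₀ P₀ bs ∷ Γ ⟶ G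
  branch-L c₀ P₀ []               (here refl) d = d
  branch-L c₀ P₀ ((c₁ , P₁) ∷ bs) (here refl) d = &L₁ d
  branch-L c₀ P₀ ((c₁ , P₁) ∷ bs) (there i)   d = &L₂ (branch-L c₁ P₁ bs i d)

  infix 4 _⇄_
  _⇄_ : Form 0 → Form 0 → Set (a ⊔ s)
  F ⇄ G = (Σᴱ ∣ [ F ] ⟶ G) × (Σᴱ ∣ [ G ] ⟶ F)

  !-cong : ∀ {F G} → F ⇄ G → ![ 𝔭 ] F ⇄ ![ 𝔭 ] G
  !-cong (d , e) = promotion ((𝔭 , _ , refl , 𝔭⊑𝔭) ∷ []) (dereliction d)
                 , promotion ((𝔭 , _ , refl , 𝔭⊑𝔭) ∷ []) (dereliction e)

  ⊸-mono : {C F G : Form 0} → Σᴱ ∣ [ F ] ⟶ G → Σᴱ ∣ [ C ⊸ F ] ⟶ C ⊸ G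
  ⊸-mono {C} {F} d = ⊸R (exch (++-comm [ C ⊸ F ] [ C ]) (⊸L init d))

  ∃-mono : {F G : Form (suc m)} (σ : Subst (functions signature) m 0) →
           (∀ t → Σᴱ ∣ [ subᶠ (σ ▸ t) F ] ⟶ subᶠ (σ ▸ t) G) →
           Σᴱ ∣ [ subᶠ σ (∃ᶠ F) ] ⟶ subᶠ σ (∃ᶠ G)
  ∃-mono {F = F} {G} σ h = ∃L x (fresh∉ xs) (∃R (var (free x))
    (subst₂ (λ F G → Σᴱ ∣ [ F ] ⟶ G) (sym (open-lift σ _ F)) (sym (open-lift σ _ G)) (h _)))
    where
    xs = concatMap fvᶠ (subᶠ σ (∃ᶠ F) ∷ subᶠ σ (∃ᶠ G) ∷ [])
    x  = fresh xs

  mutual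
    -- Congruence reaches under `local`, but sequents contain only formulas without loose indices;
    -- `σ` closes both sides.
    ≅-sound : {P Q : Proc n} → P ≅ Q → ∀ σ → subᶠ σ ⟦ P ⟧ᴾ ⇄ subᶠ σ ⟦ Q ⟧ᴾ
    ≅-sound ≅-refl        σ = init , init
    ≅-sound (≅-sym p)     σ = let d , e = ≅-sound p σ in e , d
    ≅-sound (≅-trans p q) σ =
      let d , e = ≅-sound p σ ; d′ , e′ = ≅-sound q σ in cut d d′ , cut e′ e
    ≅-sound ∥-comm        σ = ⊗L (exch (++-comm [ _ ] [ _ ]) (⊗R init init))
                            , ⊗L (exch (++-comm [ _ ] [ _ ]) (⊗R init init))
    ≅-sound ∥-assoc       σ = ⊗L (⊗L (⊗R {Γ = [ _ ]} init (⊗R init init)))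
                            , ⊗L (exch (++-comm [ _ ] [ _ ]) (⊗L
                                (exch (++-comm [ _ ] (_ ∷ _ ∷ []))
                                  (⊗R {Γ = _ ∷ _ ∷ []} (⊗R init init) init))))
    ≅-sound (∥-cong p q)  σ = let d , e = ≅-sound p σ ; d′ , e′ = ≅-sound q σ in
      ⊗L (⊗R d d′) , ⊗L (⊗R e e′)
    ≅-sound (local-cong p) σ =
      !-cong ( ∃-mono σ (λ t → proj₁ (≅-sound p (σ ▸ t)))
             , ∃-mono σ (λ t → proj₂ (≅-sound p (σ ▸ t))) )
    ≅-sound (asks-cong {bs = _ ∷ _} {_ ∷ _} ps) σ = !-cong (branches-sound ps σ)

    branches-sound : ∀ {c c′ : Con n} {P P′ bs bs′} →
                     Pointwise (λ (c , P) (c′ , P′) → c ≡ c′ × P ≅ P′)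
                               ((c , P) ∷ bs) ((c′ , P′) ∷ bs′) →
                     ∀ σ → subᶠ σ (branches c P bs) ⇄ subᶠ σ (branches c′ P′ bs′)
    branches-sound ((refl , p) ∷ []) σ = let d , e = ≅-sound p σ in ⊸-mono d , ⊸-mono e
    branches-sound ((refl , p) ∷ (q ∷ ps)) σ =
      let d , e = ≅-sound p σ ; d′ , e′ = branches-sound (q ∷ ps) σ in
      &R (&L₁ (⊸-mono d)) (&L₂ d′) , &R (&L₁ (⊸-mono e)) (&L₂ e′)

  ⟦_⟧* : List (Proc 0) → List (Form 0)
  ⟦ Γ ⟧* = List.map ⟦_⟧ᴾ Γ

  ⟦⟧*-fv : ∀ Γ → concatMap fvᶠ ⟦ Γ ⟧* ⊆ concatMap fvᴾ Γ
  ⟦⟧*-fv (P ∷ Γ) = ++-mono (⟦⟧ᴾ-fv P) (⟦⟧*-fv Γ)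

  ≋-sound : ∀ {Γ Γ′} → Γ ≋ Γ′ → ∀ {X G} →
            (Σᴱ ∣ ⟦ Γ′ ⟧* ++ X ⟶ G → Σᴱ ∣ ⟦ Γ ⟧* ++ X ⟶ G) ×
            (Σᴱ ∣ ⟦ Γ ⟧* ++ X ⟶ G → Σᴱ ∣ ⟦ Γ′ ⟧* ++ X ⟶ G)
  ≋-sound (≋-sym p)     = let f , g = ≋-sound p in g , f
  ≋-sound (≋-trans p q) = let f , g = ≋-sound p ; f′ , g′ = ≋-sound q in f ∘ f′ , g′ ∘ g
  ≋-sound (≋-perm p)    = exch (++⁺ʳ _ (map⁺ ⟦_⟧ᴾ (↭-sym p))) , exch (++⁺ʳ _ (map⁺ ⟦_⟧ᴾ p))
  ≋-sound (≋-proc {P = P} {P′} p) =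
    let d , e = subst₂ _⇄_ (subᶠ-var ⟦ P ⟧ᴾ) (subᶠ-var ⟦ P′ ⟧ᴾ) (≅-sound p var) in cut d , cut e
  ≋-sound ≋-par         = ⊗L , cut (⊗R init init)

  contents : Config → List (Form 0)
  contents ⟨ X ⨾ Γ ⨾ d ⟩ = ⟦ Γ ⟧* ++ [ ⟦ d ⟧ᶜ ]

  ≋ᶜ-sound : ∀ {C C′ G} → C ≋ᶜ C′ → contents C′ ⊨ G → contents C ⊨ G
  ≋ᶜ-sound {⟨ _ ⨾ Γ ⨾ c ⟩} {⟨ _ ⨾ Γ′ ⨾ c′ ⟩} {G} (_ , p , c⊢c′ , _) d =
    ⊨-exch (++-comm [ ⟦ c ⟧ᶜ ] ⟦ Γ ⟧*) (⊨-cut {[ ⟦ c ⟧ᶜ ]} {⟦ Γ ⟧*} (⊢⇒⊨ {c′} {c} c⊢c′)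
      (⊨-exch (++-comm ⟦ Γ ⟧* [ ⟦ c′ ⟧ᶜ ])
        (subst (Σᴱ ∣_⟶ G) (sym (List.++-assoc ⟦ Γ ⟧* _ _))
          (proj₁ (≋-sound p) (subst (Σᴱ ∣_⟶ G) (List.++-assoc ⟦ Γ′ ⟧* _ _) d)))))

  hidden-grows : ∀ {C D} → C ⟿ D → Config.hidden C ⊆ Config.hidden D
  hidden-grows step-tell       = id
  hidden-grows (step-ask _ _)  = id
  hidden-grows (step-local _ _) = there
  hidden-grows step-call       = id
  hidden-grows (step-struct p q r) =
    Equivalence.to (proj₁ r) ∘ hidden-grows q ∘ Equivalence.to (proj₁ p)

  hidden-grows* : ∀ {C D} → C ⟿* D → Config.hidden C ⊆ Config.hidden D
  hidden-grows* Star.ε        = id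
  hidden-grows* (p ◅ ps) = hidden-grows* ps ∘ hidden-grows p

  Fresh : List Name → Form 0 → Set
  Fresh X G = ∀ {x} → x ∈ X → x ∉ fvᶠ G

  -- Freshness refers to the hidden names of the target, which include the name introduced by
  -- `step-local`; the eigenvariable condition of `∃L` on `G` is exactly that. The side condition of
  -- the transition and the closedness of the theory cover the rest of the sequent.
  step-sound : ∀ {C D G} → C ⟿ D → Fresh (Config.hidden D) G → contents D ⊨ G → contents C ⊨ G
  step-sound {⟨ _ ⨾ _ ⨾ d ⟩} (step-tell {Γ = Γ} {c}) f e =
    dereliction (exch (solve 4 (λ c d g t → (c ⊕ d) ⊕ g ⊕ t ⊜ c ⊕ (g ⊕ d) ⊕ t) ↭-refl
                               [ ⟦ c ⟧ᶜ ] [ ⟦ d ⟧ᶜ ] ⟦ Γ ⟧* theory)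
      (cut (⊗R {Γ = [ ⟦ c ⟧ᶜ ]} init init)
        (exch (solve 3 (λ x g t → (g ⊕ x) ⊕ t ⊜ x ⊕ g ⊕ t) ↭-refl [ ⟦ c ⊗ d ⟧ᶜ ] ⟦ Γ ⟧* theory) e)))
  step-sound (step-ask {Γ = Γ} {(c₀ , P₀) ∷ bs} {c} {P} {d} i d⊢c) f e =
    dereliction (branch-L c₀ P₀ bs i
      (exch (solve 4 (λ b g d t → d ⊕ (b ⊕ g) ⊕ t ⊜ b ⊕ (g ⊕ d) ⊕ t) ↭-refl
                     [ ⟦ c ⟧ᶜ ⊸ ⟦ P ⟧ᴾ ] ⟦ Γ ⟧* [ ⟦ d ⟧ᶜ ] theory)
        -- The store is duplicated: one copy proves the guard, the other remains as the store of the
        -- target. The theory is copied for the same reason.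
        (proj₂ (constraint-structural ‵_ (λ _ → unb-‵) inclusion d)
          (⊨-contract {⟦ d ⟧ᶜ ∷ ⟦ d ⟧ᶜ ∷ ⟦ c ⟧ᶜ ⊸ ⟦ P ⟧ᴾ ∷ ⟦ Γ ⟧*}
            (exch (solve 4 (λ b g d t → b ⊕ (d ⊕ t) ⊕ (g ⊕ d) ⊕ t ⊜ (d ⊕ d ⊕ b ⊕ g) ⊕ t ⊕ t) ↭-refl
                           [ ⟦ c ⟧ᶜ ⊸ ⟦ P ⟧ᴾ ] ⟦ Γ ⟧* [ ⟦ d ⟧ᶜ ] theory)
              (⊸L (⊢⇒⊨ {c} {d} d⊢c) e))))))
  step-sound {G = G} (step-local {X} {Γ} {P} {d} x x∉) f e =
    dereliction (∃L x notFree
      (subst (λ F → Σᴱ ∣ F ∷ (⟦ Γ ⟧* ++ [ ⟦ d ⟧ᶜ ]) ++ theory ⟶ G)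
        (trans (⟦⟧ᴾ-ren (openWith x) P)
               (subᶠ-cong ⟦ P ⟧ᴾ (agree opened)))
        e))
    where
    opened : var ∘ openWith x ≗ instantiate (var (free x))
    opened (bound zero)    = refl
    opened (bound (suc i)) = refl
    opened (free y)        = refl
    notFree : x ∉ concatMap fvᶠ (∃ᶠ ⟦ P ⟧ᴾ ∷ G ∷ (⟦ Γ ⟧* ++ [ ⟦ d ⟧ᶜ ]) ++ theory)
    notFree x∈ with ∈-++⁻ (fvᶠ ⟦ P ⟧ᴾ) x∈
    ... | inj₁ q = x∉ (∈-++⁺ʳ X (∈-++⁺ʳ (fvᶜ d) (∈-++⁺ˡ (⟦⟧ᴾ-fv P q))))
    ... | inj₂ q with ∈-++⁻ (fvᶠ G) q
    ... | inj₁ r = f (here refl) r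
    ... | inj₂ r with ∈-concatMap-++⁻ fvᶠ (⟦ Γ ⟧* ++ [ ⟦ d ⟧ᶜ ]) r
    ... | inj₂ u = theory-closed u
    ... | inj₁ u with ∈-concatMap-++⁻ fvᶠ ⟦ Γ ⟧* u
    ... | inj₁ v = x∉ (∈-++⁺ʳ X (∈-++⁺ʳ (fvᶜ d) (∈-++⁺ʳ (fvᴾ P) (⟦⟧*-fv Γ v))))
    ... | inj₂ v = x∉ (∈-++⁺ʳ X (∈-++⁺ˡ
                     (Eᴱ.formula-fv d (⊆-reflexive (List.++-identityʳ (fvᶠ ⟦ d ⟧ᶜ)) v))))
  step-sound {G = G} (step-call {Γ = Γ} {p} {ys} {d}) f e =
    use {Δ = callFormula p ys ∷ ⟦ Γ ⟧* ++ [ ⟦ d ⟧ᶜ ]} theory-structural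
      (∈-++⁺ʳ ⟦Δ⟧ (∈-map⁺ ⟦_⟧ᴰ (∈-allFin p)))
      (dereliction (∀⋆L (callFormula p (formals p) ⊸ ⟦ body p ⟧ᴾ) (var ∘ parameters ys) (λ _ → refl)
        (subst₂ (λ A F → Σᴱ ∣ A ⊸ F ∷ callFormula p ys ∷ (⟦ Γ ⟧* ++ [ ⟦ d ⟧ᶜ ]) ++ theory ⟶ G)
          (cong (λ us → ![ 𝔡 ] atom (inj₂ p · us)) actuals)
          (⟦⟧ᴾ-ren (parameters ys) (body p))
          (⊸L {Γ = [ callFormula p ys ]} init e))))
    where
    actuals : Vec.map var ys ≡ subᵗˢ (var ∘ parameters ys) (Vec.map var (formals p))
    actuals = trans (cong (Vec.map var) (sym (Vec.map-lookup-allFin ys)))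
      (trans (sym (Vec.map-∘ var (Vec.lookup ys) (Vec.allFin _)))
        (trans (Vec.map-∘ (var ∘ parameters ys) bound (Vec.allFin _))
               (sym (subᵗˢ-map-var (var ∘ parameters ys) (formals p)))))
  step-sound (step-struct {C} {C′} {D} {D′} p q r) f e =
    ≋ᶜ-sound {C} {C′} p (step-sound q (f ∘ Equivalence.to (proj₁ r)) (≋ᶜ-sound {D′} {D} r e))

  steps-sound : ∀ {C D G} → C ⟿* D → Fresh (Config.hidden D) G → contents D ⊨ G → contents C ⊨ G
  steps-sound Star.ε        f e = e
  steps-sound (p ◅ ps) f e =
    step-sound p (f ∘ hidden-grows* ps) (steps-sound ps f e)

  hide-fresh : ∀ X d → Fresh X ⟦ hide X d ⟧ᶜ
  hide-fresh (x ∷ X) d (here refl) y∈ = proj₁ (Eᴱ.formula-abstract-fv x (hide X d) y∈) refl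
  hide-fresh (x ∷ X) d (there y∈X) y∈ =
    hide-fresh X d y∈X (proj₂ (Eᴱ.formula-abstract-fv x (hide X d) y∈))

  hide-R : ∀ X d → Σᴱ ∣ [ ⟦ d ⟧ᶜ ] ⟶ ⟦ hide X d ⟧ᶜ
  hide-R []      d = init
  hide-R (x ∷ X) d = ∃R (var (free x))
    (subst (Σᴱ ∣ [ ⟦ d ⟧ᶜ ] ⟶_) (sym (Eᴱ.formula-reopen x (hide X d))) (hide-R X d))

  -- `step-local` keeps new names out of the configuration but not out of `c`, so `c ⊗ ⊤` need not
  -- be fresh along the execution. `hide X d ⊗ ⊤` is, and it is exchanged for `c ⊗ ⊤` by a cut at
  -- the initial configuration.
  adequacy⇒ : (P : Proc 0) (c : Con 0) → P ⇓ c →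
              Σᴱ ∣ ⟦Δ⟧ ++ ⟦Ψ⟧ ++ [ ⟦ P ⟧ᴾ ] ⟶ ⟦ c ⟧ᶜ ⊗ ⊤ᶠ
  adequacy⇒ P c (X , Γ , d , steps , h) =
    exch (solve 3 (λ x y z → z ⊕ x ⊕ y ⊜ x ⊕ y ⊕ z) ↭-refl ⟦Δ⟧ ⟦Ψ⟧ [ ⟦ P ⟧ᴾ ])
      (⊨-cut {[ ⟦ P ⟧ᴾ ]} {[]} observed
        (⊗L (exch (solve 3 (λ x y z → (x ⊕ z) ⊕ y ⊜ x ⊕ y ⊕ z) ↭-refl
                           [ ⟦ hide X d ⟧ᶜ ] [ ⊤ᶠ ] theory)
          (⊗R (⊢⇒⊨ {c} {hide X d} h) (⊤R {Γ = [ ⊤ᶠ ]})))))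
    where
    final : contents ⟨ X ⨾ Γ ⨾ d ⟩ ⊨ ⟦ hide X d ⟧ᶜ ⊗ ⊤ᶠ
    final = exch (solve 3 (λ d g t → d ⊕ g ⊕ t ⊜ (g ⊕ d) ⊕ t) ↭-refl [ ⟦ d ⟧ᶜ ] ⟦ Γ ⟧* theory)
              -- `⊤` takes the processes that have not run, together with the theory.
              (⊗R (hide-R X d) ⊤R)
    observed : [ ⟦ P ⟧ᴾ ] ⊨ ⟦ hide X d ⟧ᶜ ⊗ ⊤ᶠ
    observed = cut 𝟏R (⊨-exch (++-comm [ ⟦ P ⟧ᴾ ] [ 𝟏 ])
      (steps-sound steps (λ x∈X → hide-fresh X d x∈X ∘ ⊆-reflexive (List.++-identityʳ _)) final))

-- From proofs to executions

module Adequacy⇐ {a s} (𝒞 : SoftConstraintSystem a s)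
                 (Ψ : Definitions (SoftConstraintSystem.Carrier 𝒞)
                                  (SoftConstraintSystem.signature 𝒞)) where

  open SoftConstraintSystem 𝒞
  open Definitions Ψ
  open Semantics 𝒞 Ψ
  open Encoding 𝒞 Ψ
  open ExtSignature semiring hiding (Σᴱ)
  open EncodingProperties 𝒞 Ψ
  open Embed 𝒞 Ψ
  open CutAdmissibility {Σ = Σ₀} {S = signature}

  ⌊_⌋ : Con n → Form₀ n
  ⌊_⌋ = E₀.formula

  ⌊_⌋* : List (Con 0) → List (Form₀ 0)
  ⌊_⌋* = List.map ⌊_⌋

  ⌊⌋-fv : (c : Con n) → fvᶠ ⟦ c ⟧ᶜ ≡ fvᶠ ⌊ c ⌋
  ⌊⌋-fv c = trans (cong fvᶠ (sym (embed-formula c))) (embed-fv ⌊ c ⌋)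

  infix 2 _⊢₀_
  _⊢₀_ : List (Form₀ 0) → Form₀ 0 → Set (a ⊔ s)
  Γ ⊢₀ G = Σ₀ ∣ ⟦Δ⟧₀ ++ Γ ⟶ G

  Δ-structural : All Structural ⟦Δ⟧₀
  Δ-structural = All.map⁺ (All.tabulate λ _ → box-structural _)

  store-structural : ∀ D → All Structural ⌊ D ⌋*
  store-structural D = All.map⁺ (All.tabulate λ {c} _ → constraint-structural id _ id c)

  Δ-closed : ∀ {x} → x ∉ concatMap fvᶠ ⟦Δ⟧₀
  Δ-closed x∈ with find (∈-concatMap⁻ fvᶠ {⟦Δ⟧₀} x∈)
  ... | F , F∈ , x∈F with ∈-map⁻ (λ δ → ![ ⊤A ] E₀.axiomFormula δ) F∈
  ...   | δ , _ , refl = contradiction (E₀.axiomFormula-closed δ x∈F) λ ()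

  ⊢₀-exch : ∀ {Γ Γ′ G} → Γ ↭ Γ′ → Γ ⊢₀ G → Γ′ ⊢₀ G
  ⊢₀-exch p = exch (++⁺ˡ ⟦Δ⟧₀ p)

  ⊢₀-pure : ∀ {Γ G} → Σ₀ ∣ Γ ⟶ G → Γ ⊢₀ G
  ⊢₀-pure = discards Δ-structural

  ⊢₀-cut : ∀ {Γ Γ′ F G} → Γ ⊢₀ F → F ∷ Γ′ ⊢₀ G → Γ ++ Γ′ ⊢₀ G
  ⊢₀-cut {Γ} {Γ′} {F} d e = duplicates Δ-structural
    (exch (solve 3 (λ t g h → (t ⊕ g) ⊕ t ⊕ h ⊜ t ⊕ t ⊕ g ⊕ h) ↭-refl ⟦Δ⟧₀ Γ Γ′)
      (cut d (exch (↭-shift F ⟦Δ⟧₀ Γ′) e)))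

  ⊢₀-left : ∀ {Γ Γ′ Θ o} → (∀ {Ξ} → Σ₀ ∣ Γ ++ Ξ ⟶ o → Σ₀ ∣ Γ′ ++ Ξ ⟶ o) →
            Γ ++ Θ ⊢₀ o → Γ′ ++ Θ ⊢₀ o
  ⊢₀-left {Γ} {Γ′} {Θ} f d =
    exch (solve 3 (λ g t h → g ⊕ t ⊕ h ⊜ t ⊕ g ⊕ h) ↭-refl Γ′ ⟦Δ⟧₀ Θ)
      (f (exch (solve 3 (λ g t h → t ⊕ g ⊕ h ⊜ g ⊕ t ⊕ h) ↭-refl Γ ⟦Δ⟧₀ Θ) d))

  store-++ : ∀ D D′ → ⌊ D ++ D′ ⌋* ≡ ⌊ D ⌋* ++ ⌊ D′ ⌋*
  store-++ = List.map-++ ⌊_⌋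

  -- Runs: executions with lists of constraints as stores

  Entails : List (Con 0) → Form₀ 0 → Set (a ⊔ s)
  Entails D o = ⌊ D ⌋* ⊢₀ o

  -- Stores are lists so that states form a monoid under concatenation, and congruence is reduced to
  -- permuting processes and opening `∥`. `done` accepts leftover processes, as `⊤` does in the
  -- sequent.
  data Run : List (Proc 0) → List (Con 0) → Form₀ 0 → Set (a ⊔ s) where
    done  : ∀ {Γ D o} → Entails D o → Run Γ D o
    perm  : ∀ {Γ Γ′ D o} → Γ ↭ Γ′ → Run Γ D o → Run Γ′ D o
    tell  : ∀ {Γ D c o} → Run Γ (c ∷ D) o → Run (tell c ∷ Γ) D o
    ask   : ∀ {Γ D bs c P o} → (c , P) ∈ toList bs → Entails D ⌊ c ⌋ →
            Run (P ∷ Γ) D o → Run (asks bs ∷ Γ) D o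
    par   : ∀ {Γ D P Q o} → Run (P ∷ Q ∷ Γ) D o → Run (P ∥ Q ∷ Γ) D o
    -- Cofinite quantification over the fresh name: no renaming of runs is needed,
    -- and hidden names need not be recorded, as they can be kept out of o.
    local : ∀ {Γ D P o} (L : List Name) → (∀ x → x ∉ L → Run (renᴾ (openWith x) P ∷ Γ) D o) →
            Run (local P ∷ Γ) D o
    call  : ∀ {Γ D p ys o} → Run (renᴾ (parameters ys) (body p) ∷ Γ) D o →
            Run (call p ys ∷ Γ) D o

  Avoids : List Name → Form₀ 0 → Set
  Avoids X F = Disjoint X (fvᶠ F)

  -- Names are counted in the encoding, so that `fvᶠ-sub` and `⟦⟧ᴾ-ren` also settle the free names
  -- of renamed processes.
  Avoidsᴾ : List Name → Proc 0 → Set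
  Avoidsᴾ X P = Disjoint X (fvᶠ ⟦ P ⟧ᴾ)

  -- The constraints E make refinement stable under tell, and the names X allow an
  -- instance c[x] to be refined by ∃x.c.
  Refines : List Name → List (Con 0) → List (Con 0) → Set (a ⊔ s)
  Refines X D′ D = ∀ E {o} → All (Avoids X ∘ ⌊_⌋) E → Avoids X o →
                   Entails (D ++ E) o → Entails (D′ ++ E) o

  refines-entails : ∀ {X D′ D o} → Refines X D′ D → Avoids X o → Entails D o → Entails D′ o
  refines-entails {D′ = D′} {D} {o} r x d =
    subst (λ D → Entails D o) (List.++-identityʳ D′)
      (r [] [] x (subst (λ D → Entails D o) (sym (List.++-identityʳ D)) d))

  refines-∷ : ∀ {X D′ D c} → Avoids X ⌊ c ⌋ → Refines X D′ D → Refines X (c ∷ D′) (c ∷ D)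
  refines-∷ {D′ = D′} {D} {c} x r E xs y d =
    ⊢₀-exch (map⁺ ⌊_⌋ (↭-shift c D′ E))
      (r (c ∷ E) (x ∷ xs) y (⊢₀-exch (map⁺ ⌊_⌋ (↭-sym (↭-shift c D E))) d))

  branch-fv : ∀ {c P} (c₀ : Con 0) (P₀ : Proc 0) bs → (c , P) ∈ (c₀ , P₀) ∷ bs →
              (fvᶠ ⟦ c ⟧ᶜ ⊆ fvᶠ (branches c₀ P₀ bs)) × (fvᶠ ⟦ P ⟧ᴾ ⊆ fvᶠ (branches c₀ P₀ bs))
  branch-fv c₀ P₀ []               (here refl) = ∈-++⁺ˡ , ∈-++⁺ʳ (fvᶠ ⟦ c₀ ⟧ᶜ)
  branch-fv c₀ P₀ ((c₁ , P₁) ∷ bs) (here refl) = ∈-++⁺ˡ ∘ ∈-++⁺ˡ , ∈-++⁺ˡ ∘ ∈-++⁺ʳ (fvᶠ ⟦ c₀ ⟧ᶜ)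
  branch-fv c₀ P₀ ((c₁ , P₁) ∷ bs) (there i)   = let f , g = branch-fv c₁ P₁ bs i in
    ∈-++⁺ʳ (fvᶠ (⟦ c₀ ⟧ᶜ ⊸ ⟦ P₀ ⟧ᴾ)) ∘ f , ∈-++⁺ʳ (fvᶠ (⟦ c₀ ⟧ᶜ ⊸ ⟦ P₀ ⟧ᴾ)) ∘ g

  open-avoids : ∀ {X x} (P : Proc 1) → x ∉ X → Disjoint X (fvᶠ ⟦ P ⟧ᴾ) →
                Avoidsᴾ X (renᴾ (openWith x) P)
  open-avoids {x = x} P x∉X f (y∈X , y∈)
    with fvᶠ-sub (var ∘ openWith x) ⟦ P ⟧ᴾ (subst (λ F → _ ∈ fvᶠ F) (⟦⟧ᴾ-ren (openWith x) P) y∈)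
  ... | bound zero , _  , here refl = x∉X y∈X
  ... | free y     , v⊆ , here refl = f (y∈X , v⊆ (here refl))

  call-avoids : ∀ {X p} ys → Avoidsᴾ X (call p ys) → Avoidsᴾ X (renᴾ (parameters ys) (body p))
  call-avoids {p = p} ys f (y∈X , y∈)
    with fvᶠ-sub (var ∘ parameters ys) ⟦ body p ⟧ᴾ
           (subst (λ F → _ ∈ fvᶠ F) (⟦⟧ᴾ-ren (parameters ys) (body p)) y∈)
  ... | bound i , _  , q = f (y∈X , fv-lookup ys i q)
    where
    fv-lookup : ∀ (ys : Vec (Var 0) k) i →
                fvᵛ (Vec.lookup ys i) ⊆ fvᵗˢ {F = functions signature} (Vec.map var ys)
    fv-lookup (y ∷ ys) zero    = ∈-++⁺ˡ
    fv-lookup (y ∷ ys) (suc i) = ∈-++⁺ʳ (fvᵛ y) ∘ fv-lookup ys i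
  ... | free z  , v⊆ , q with ⊆-reflexive (closed p) (⟦⟧ᴾ-fv (body p) (v⊆ (here refl)))
  ... | ()

  -- Whatever a run tells or asks comes from `Γ` and hence avoids `X`, which keeps it within the
  -- range of `Refines`. At `local` the excluded names are enlarged by `X`, so the new name avoids
  -- it as well.
  run-refine : ∀ {X Γ D D′ o} → All (Avoidsᴾ X) Γ → Avoids X o → Refines X D′ D →
               Run Γ D o → Run Γ D′ o
  run-refine fs f r (done d)           = done (refines-entails r f d)
  run-refine fs f r (perm p d)         = perm p (run-refine (All-resp-↭ (↭-sym p) fs) f r d)
  run-refine {X} (g ∷ fs) f r (tell {c = c} d) =
    tell (run-refine fs f (refines-∷ (subst (Disjoint X) (⌊⌋-fv c) g) r) d)
  run-refine {X} (g ∷ fs) f r (ask {bs = (c₀ , P₀) ∷ bs} {c} i e d) =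
    let h , k = branch-fv c₀ P₀ bs i in
    ask i (refines-entails r (subst (Disjoint X) (⌊⌋-fv c) (λ (x , y) → g (x , h y))) e)
      (run-refine ((λ (x , y) → g (x , k y)) ∷ fs) f r d)
  run-refine (g ∷ fs) f r (par {P = P} d) =
    par (run-refine ((λ (x , y) → g (x , ∈-++⁺ˡ y)) ∷
                     (λ (x , y) → g (x , ∈-++⁺ʳ (fvᶠ ⟦ P ⟧ᴾ) y)) ∷ fs) f r d)
  run-refine {X} (g ∷ fs) f r (local {P = P} L h) = local (X ++ L) λ x x∉ →
    run-refine (open-avoids P (x∉ ∘ ∈-++⁺ˡ) g ∷ fs) f r (h x (x∉ ∘ ∈-++⁺ʳ X))
  run-refine (g ∷ fs) f r (call {ys = ys} d) = call (run-refine (call-avoids ys g ∷ fs) f r d)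

  run-mono : ∀ {Γ D D′ o} → Refines [] D′ D → Run Γ D o → Run Γ D′ o
  run-mono r = run-refine (All.tabulate λ { _ (() , _) }) (λ { (() , _) }) r

  refines-↭ : ∀ {D D′} → D ↭ D′ → Refines [] D′ D
  refines-↭ p E _ _ = ⊢₀-exch (map⁺ ⌊_⌋ (++⁺ʳ E p))

  refines-left : ∀ D D′ F → (∀ {Ξ o} → Σ₀ ∣ ⌊ D ⌋* ++ Ξ ⟶ o → Σ₀ ∣ ⌊ D′ ⌋* ++ Ξ ⟶ o) →
                 Refines [] (D′ ++ F) (D ++ F)
  refines-left D D′ F f E {o} _ _ d =
    subst (_⊢₀ o) (sym (parts D′)) (⊢₀-left f (subst (_⊢₀ o) (parts D) d))
    where
    parts : ∀ D → ⌊ (D ++ F) ++ E ⌋* ≡ ⌊ D ⌋* ++ ⌊ F ++ E ⌋*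
    parts D = trans (cong ⌊_⌋* (List.++-assoc D F E)) (store-++ D (F ++ E))

  run-discard : ∀ {Γ D o} D′ → Run Γ D o → Run Γ (D′ ++ D) o
  run-discard {D = D} D′ = run-mono (refines-left [] D′ D (discards (store-structural D′)))

  run-duplicate : ∀ {Γ D o} D′ → Run Γ (D′ ++ (D′ ++ D)) o → Run Γ (D′ ++ D) o
  run-duplicate {Γ} {D} {o} D′ d =
    run-mono (refines-left (D′ ++ D′) D′ D λ {Ξ} e →
        duplicates (store-structural D′)
          (subst (Σ₀ ∣_⟶ _) (trans (cong (_++ Ξ) (store-++ D′ D′)) (List.++-assoc ⌊ D′ ⌋* _ _)) e))
      (subst (λ D → Run Γ D o) (sym (List.++-assoc D′ D′ D)) d)

  run-more : ∀ {Γ D o} Γ′ → Run Γ D o → Run (Γ ++ Γ′) D o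
  run-more Γ′ (done d)    = done d
  run-more Γ′ (perm p d)  = perm (++⁺ʳ Γ′ p) (run-more Γ′ d)
  run-more Γ′ (tell d)    = tell (run-more Γ′ d)
  run-more Γ′ (ask i e d) = ask i e (run-more Γ′ d)
  run-more Γ′ (par d)     = par (run-more Γ′ d)
  run-more Γ′ (local L h) = local L λ x x∉ → run-more Γ′ (h x x∉)
  run-more Γ′ (call d)    = call (run-more Γ′ d)

  entails-more : ∀ {D o} D′ → Entails D o → Entails (D ++ D′) o
  entails-more {D} {o} D′ d = subst (_⊢₀ o) (sym (store-++ D D′))
    (⊢₀-exch (++-comm ⌊ D′ ⌋* ⌊ D ⌋*) (⊢₀-left {Γ = []} (discards (store-structural D′)) d))

  -- Where the first run ends, its store entails `c` and so refines it; the second run continues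
  -- from there while the leftovers of the first stay idle.
  run-cut : ∀ {Γ Γ′ D D′ c o} → Run Γ D ⌊ c ⌋ → Run Γ′ (c ∷ D′) o → Run (Γ ++ Γ′) (D ++ D′) o
  run-cut {Γ} {Γ′} {D} {D′} (done d) r = perm (++-comm Γ′ Γ) (run-more Γ (run-mono refines r))
    where
    refines : Refines [] (D ++ D′) (_ ∷ D′)
    refines E {o} _ _ e = subst (_⊢₀ o)
      (trans (sym (store-++ D (D′ ++ E))) (cong ⌊_⌋* (sym (List.++-assoc D D′ E))))
      (⊢₀-cut {⌊ D ⌋*} {⌊ D′ ++ E ⌋*} d e)
  run-cut {Γ′ = Γ′} (perm p d)  r = perm (++⁺ʳ Γ′ p) (run-cut d r)
  run-cut (tell d)    r = tell (run-cut d r)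
  run-cut {D = D} {D′} (ask i e d) r = ask i (entails-more {D} D′ e) (run-cut d r)
  run-cut (par d)     r = par (run-cut d r)
  run-cut (local L h) r = local L λ x x∉ → run-cut (h x x∉) r
  run-cut (call d)    r = call (run-cut d r)

  run-entails : ∀ {Γ D c o} → Run Γ D ⌊ c ⌋ → Entails [ c ] o → Run Γ D o
  run-entails {Γ} {D} {c} {o} r d =
    perm (++-identityʳ Γ) (run-mono (refines-↭ (++-identityʳ D))
      (run-cut {Γ′ = []} {D′ = []} r (done d)))

  run-pure : ∀ {D o} → Run [] D o → Entails D o
  run-pure d = go d refl
    where
    go : ∀ {Γ D o} → Run Γ D o → Γ ≡ [] → Entails D o
    go (done d)   e    = d
    go (perm p d) refl = go d (↭-empty-inv p)

  -- Only the labels of 𝒜 carry information: a state in Modal (‵ l) has no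
  -- processes, so that an observation of it can be promoted.
  runs : PhaseModel Σᴱ signatureᴱ
  runs = record
    { states      = commutativeMonoid (++-commutativeMonoid {A = Proc 0})
                                      (++-commutativeMonoid {A = Con 0})
    ; Observation = Form₀ 0
    ; _⊩_         = λ (Γ , D) o → Run Γ D o
    ; ⊩-resp-≈    = λ (p , q) r → perm p (run-mono (refines-↭ q) r)
    ; Atomic      = Atomic
    ; Modal       = Modal
    ; modal-ε     = modal-ε
    ; modal-∙     = modal-∙
    ; modal-≼     = modal-≼
    ; discard     = discard
    ; duplicate   = duplicate
    }
    where
    State : Set (a ⊔ s)
    State = List (Proc 0) × List (Con 0)

    -- An atom of `𝒫` is something to be observed. An atom of a process name is the call itself, so
    -- that the antecedent of an encoded definition identifies the process to be unfolded.
    Atomic : Atom signatureᴱ 0 → State → Set (a ⊔ s)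
    Atomic (inj₁ p · ts) (Γ , D) = Run Γ D (atom (p · ts))
    Atomic (inj₂ p · ts) x       = ∃[ ys ] ts ≡ Vec.map var ys × x ≡ ([ call p ys ] , [])

    -- The bounded labels impose nothing, so boxes with `𝔭` and `𝔡` denote the same as their
    -- contents. `𝔲` and `⊤ᶜ` allow only the empty state, which may be copied and at which the
    -- definitions hold.
    Modal : ExtLabel Carrier → State → Set (a ⊔ s)
    Modal (‵ l) (Γ , D) = Γ ≡ [] × All (λ c → ∃[ k ] ∃[ F ] ⌊ c ⌋ ≡ ![ k ] F × l ≤ k) D
    Modal 𝔭     x       = ⊤
    Modal 𝔡     x       = ⊤
    Modal 𝔲     x       = x ≡ ([] , [])
    Modal ⊥ᶜ    x       = ⊤
    Modal ⊤ᶜ    x       = x ≡ ([] , [])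

    modal-ε : ∀ l → Modal l ([] , [])
    modal-ε (‵ l) = refl , []
    modal-ε 𝔭     = _
    modal-ε 𝔡     = _
    modal-ε 𝔲     = refl
    modal-ε ⊥ᶜ    = _
    modal-ε ⊤ᶜ    = refl

    modal-∙ : ∀ l {x y} → Modal l x → Modal l y → Modal l (proj₁ x ++ proj₁ y , proj₂ x ++ proj₂ y)
    modal-∙ (‵ l) (refl , p) (refl , q) = refl , All.++⁺ p q
    modal-∙ 𝔭     _ _       = _
    modal-∙ 𝔡     _ _       = _
    modal-∙ 𝔲     refl refl = refl
    modal-∙ ⊥ᶜ    _ _       = _
    modal-∙ ⊤ᶜ    refl refl = refl

    modal-≼ : ∀ {l k x} → l ⊑ k → Modal k x → Modal l x
    modal-≼ (‵⊑‵ l≤k) (refl , p) =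
      refl , All.map (λ (j , F , e , k≤j) → j , F , e , ≤-trans l≤k k≤j) p
    modal-≼ 𝔭⊑𝔭     p    = p
    modal-≼ 𝔡⊑𝔡     p    = p
    modal-≼ 𝔲⊑𝔲     p    = p
    modal-≼ ⊥ᶜ⊑     p    = _
    modal-≼ (⊑⊤ᶜ {l}) refl = modal-ε l

    discard : ∀ {l x y o} → Unb l → Modal l x → Run (proj₁ y) (proj₂ y) o →
              Run (proj₁ x ++ proj₁ y) (proj₂ x ++ proj₂ y) o
    discard {x = x} unb-‵ (refl , _) r = run-discard (proj₂ x) r
    discard unb-𝔲  refl       r = r
    discard unb-⊤ᶜ refl       r = r

    duplicate : ∀ {l x y o} → Unb l → Modal l x →
                Run (proj₁ x ++ proj₁ x ++ proj₁ y) (proj₂ x ++ proj₂ x ++ proj₂ y) o →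
                Run (proj₁ x ++ proj₁ y) (proj₂ x ++ proj₂ y) o
    duplicate {x = x} unb-‵ (refl , _) r = run-duplicate (proj₂ x) r
    duplicate unb-𝔲  refl       r = r
    duplicate unb-⊤ᶜ refl       r = r

  -- Constraints, processes and the theory in the model of runs

  open Phase runs
  open PhaseModel runs using (State; _∙_; _⊩_; Modal)

  stored : Con 0 → State
  stored c = [] , [ c ]

  running : Proc 0 → State
  running P = [ P ] , []

  run-left : ∀ {Γ D o} D′ D″ → (∀ {Ξ o} → Σ₀ ∣ ⌊ D′ ⌋* ++ Ξ ⟶ o → Σ₀ ∣ ⌊ D″ ⌋* ++ Ξ ⟶ o) →
             Run Γ (D′ ++ D) o → Run Γ (D″ ++ D) o
  run-left {D = D} D′ D″ f = run-mono (refines-left D′ D″ D f)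

  -- The body of !ˡ(!ˡA₁ ⊗ ⋯ ⊗ !ˡAₙ) as a constraint.
  tensor : Carrier → Atom signature n → List (Atom signature n) → Con n
  tensor l A []       = ![ l ] A
  tensor l A (B ∷ Bs) = (![ l ] A) ⊗ tensor l B Bs

  tensor-formula : ∀ l (A : Atom signature n) Bs →
                   ⌊ tensor l A Bs ⌋ ≡ List⁺.foldr₁ _⊗_ (List⁺.map (λ A → ![ l ] atom A) (A ∷ Bs))
  tensor-formula l A []       = refl
  tensor-formula l A (B ∷ Bs) = cong (_ ⊗_) (tensor-formula l B Bs)

  tensor-formulaᴱ : ∀ l (A : Atom signature n) Bs → ⟦ tensor l A Bs ⟧ᶜ ≡
                    List⁺.foldr₁ _⊗_ (List⁺.map (λ A → ![ ‵ l ] atom (inclusion A)) (A ∷ Bs))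
  tensor-formulaᴱ l A []       = refl
  tensor-formulaᴱ l A (B ∷ Bs) = cong (_ ⊗_) (tensor-formulaᴱ l B Bs)

  ⊗-holds : ∀ {F G : Form n} {σ c d} → ⟪ F ⟫ σ (stored c) → ⟪ G ⟫ σ (stored d) →
            ⟪ F ⊗ G ⟫ σ (stored (c ⊗ d))
  ⊗-holds {c = c} {d} p q y o h = run-left (c ∷ d ∷ []) [ c ⊗ d ] ⊗L (h _ (_ , _ , p , q , refl))

  !-holds : ∀ l (A : Atom signature n) σ →
            ⟪ ![ ‵ l ] atom (inclusion A) ⟫ σ (stored (![ l ] subᵃ σ A))
  !-holds l (p · ts) σ =
    η ((refl , (_ , _ , refl , ≤-reflexive refl) ∷ []) , η (done (⊢₀-pure (dereliction init))))

  tensor-holds : ∀ l (A : Atom signature n) Bs σ →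
                 ⟪ ⟦ tensor l A Bs ⟧ᶜ ⟫ σ (stored (tensor l (subᵃ σ A) (List.map (subᵃ σ) Bs)))
  tensor-holds l A []       σ = !-holds l A σ
  tensor-holds l A (B ∷ Bs) σ =
    ⊗-holds {F = ![ ‵ l ] atom (inclusion A)} {⟦ tensor l B Bs ⟧ᶜ}
            (!-holds l A σ) (tensor-holds l B Bs σ)

  -- With `constraint-observed` this is the analogue of `reflect` and `reify`: a told constraint is
  -- supplied by storing it, and a guard or an antecedent is used by observing it.
  stored-holds : ∀ (c : Con n) σ → ⟪ ⟦ c ⟧ᶜ ⟫ σ (stored (subᶜ σ c))
  stored-holds 𝟏          σ y o h = run-left [] [ 𝟏 ] 𝟏L (h _ refl)
  stored-holds (c ⊗ d)    σ = ⊗-holds {F = ⟦ c ⟧ᶜ} {⟦ d ⟧ᶜ} (stored-holds c σ) (stored-holds d σ)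
  stored-holds (∃ᶜ c)     σ (Γ , D) o h =
    -- The run starting from the instance at a fresh `x` is refined to one starting from `∃x.c`:
    -- only its entailments change, each by an `∃L` with eigenvariable `x`.
    run-refine {X = [ x ]} (avoidsΓ Γ id) avoidsO refines
      (h _ (var (free x) , stored-holds c (σ ▸ var (free x))))
    where
    c′ = subᶜ (liftˢ σ) c
    xs = fvᶠ ⌊ c′ ⌋ ++ fvᶠ o ++ concatMap fvᶠ ⌊ D ⌋* ++ concatMap (fvᶠ ∘ ⟦_⟧ᴾ) Γ
    x  = fresh xs
    avoids : ∀ {ys} → ys ⊆ xs → Disjoint [ x ] ys
    avoids ys⊆xs (here refl , y∈) = fresh∉ xs (ys⊆xs y∈)
    avoidsO : Avoids [ x ] o
    avoidsO = avoids (∈-++⁺ʳ (fvᶠ ⌊ c′ ⌋) ∘ ∈-++⁺ˡ)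
    avoidsΓ : ∀ Δ → concatMap (fvᶠ ∘ ⟦_⟧ᴾ) Δ ⊆ concatMap (fvᶠ ∘ ⟦_⟧ᴾ) Γ → All (Avoidsᴾ [ x ]) Δ
    avoidsΓ []      _ = []
    avoidsΓ (P ∷ Δ) f =
      avoids (∈-++⁺ʳ (fvᶠ ⌊ c′ ⌋) ∘ ∈-++⁺ʳ (fvᶠ o) ∘ ∈-++⁺ʳ (concatMap fvᶠ ⌊ D ⌋*) ∘ f ∘ ∈-++⁺ˡ)
      ∷ avoidsΓ Δ (f ∘ ∈-++⁺ʳ (fvᶠ ⟦ P ⟧ᴾ))
    x∉E : ∀ E → All (Avoids [ x ] ∘ ⌊_⌋) E → x ∉ concatMap fvᶠ ⌊ E ⌋*
    x∉E (e ∷ E) (f ∷ fs) x∈ with ∈-++⁻ (fvᶠ ⌊ e ⌋) x∈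
    ... | inj₁ q = f (here refl , q)
    ... | inj₂ q = x∉E E fs q
    refines : Refines [ x ] (∃ᶜ c′ ∷ D) (subᶜ (σ ▸ var (free x)) c ∷ D)
    refines E {o′} fs f e = exch (↭-sym (↭-shift (∃ᶠ ⌊ c′ ⌋) ⟦Δ⟧₀ ⌊ D ++ E ⌋*))
      (∃L x x∉ (subst (λ F → Σ₀ ∣ F ∷ ⟦Δ⟧₀ ++ ⌊ D ++ E ⌋* ⟶ o′) (E₀.formula-open σ _ c)
        (exch (↭-shift _ ⟦Δ⟧₀ ⌊ D ++ E ⌋*) e)))
      where
      x∉ : x ∉ fvᶠ ⌊ c′ ⌋ ++ fvᶠ o′ ++ concatMap fvᶠ (⟦Δ⟧₀ ++ ⌊ D ++ E ⌋*)
      x∉ x∈ with ∈-++⁻ (fvᶠ ⌊ c′ ⌋) x∈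
      ... | inj₁ q = fresh∉ xs (∈-++⁺ˡ q)
      ... | inj₂ q with ∈-++⁻ (fvᶠ o′) q
      ... | inj₁ q = f (here refl , q)
      ... | inj₂ q with ∈-concatMap-++⁻ fvᶠ ⟦Δ⟧₀ q
      ... | inj₁ q = Δ-closed q
      ... | inj₂ q with ∈-concatMap-++⁻ fvᶠ ⌊ D ⌋* (⊆-reflexive (cong (concatMap fvᶠ) (store-++ D E)) q)
      ... | inj₁ q = fresh∉ xs (∈-++⁺ʳ (fvᶠ ⌊ c′ ⌋) (∈-++⁺ʳ (fvᶠ o) (∈-++⁺ˡ q)))
      ... | inj₂ q = x∉E E fs q
  stored-holds (![ l ] A) σ = !-holds l A σ
  stored-holds (![ l ]⨂ (A ∷ Bs)) σ =
    -- The state must itself be boxed to be modal, so the whole box is stored; its tensor is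
    -- recovered by dereliction inside the store.
    η ( (refl , (_ , _ , refl , ≤-reflexive refl) ∷ [])
      , subst (λ F → ⟪ F ⟫ σ (stored (subᶜ σ (![ l ]⨂ (A ∷ Bs))))) (tensor-formulaᴱ l A Bs)
          (fact ⟦ tensor l A Bs ⟧ᶜ σ λ y o h →
            run-left [ tensor l A′ Bs′ ] [ ![ l ]⨂ (A′ ∷ Bs′) ]
              (λ {Ξ} {o} d → dereliction (subst (λ F → Σ₀ ∣ F ∷ Ξ ⟶ o) (tensor-formula l A′ Bs′) d))
              (h _ (tensor-holds l A Bs σ))))
    where
    A′  = subᵃ σ A
    Bs′ = List.map (subᵃ σ) Bs

  ⊗-observed : ∀ {x y c d} → x ⊩ ⌊ c ⌋ → y ⊩ ⌊ d ⌋ → x ∙ y ⊩ ⌊ c ⊗ d ⌋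
  ⊗-observed {c = c} {d} p q =
    run-cut p (perm (++-identityʳ _) (run-mono (refines-↭ (++-comm _ [ c ]))
      (run-cut {Γ′ = []} {D′ = [ c ]} q
        (done (⊢₀-pure (exch (++-comm [ ⌊ c ⌋ ] [ ⌊ d ⌋ ]) (⊗R init init)))))))

  -- Without processes a run is a plain entailment, and its hypotheses are all boxed at `l` or
  -- above: the store by modality, the axioms because `⊤A` absorbs in sums and so lies above every
  -- label of `𝒜`.
  !-observed : ∀ {l x F} → Modal (‵ l) x → x ⊩ F → x ⊩ ![ l ] F
  !-observed {l} (refl , bs) r = done (promotion (All.++⁺ Δ-boxed (All.map⁺ bs)) (run-pure r))
    where
    Δ-boxed : Boxed Σ₀ l ⟦Δ⟧₀
    Δ-boxed = All.map⁺ (All.tabulate λ _ → ⊤A , _ , refl , proj₂ +-zero l)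

  tensor-observed : ∀ l (A : Atom signature n) Bs σ {x} → ⟪ ⟦ tensor l A Bs ⟧ᶜ ⟫ σ x →
                    x ⊩ ⌊ tensor l (subᵃ σ A) (List.map (subᵃ σ) Bs) ⌋
  atom-observed : ∀ l (A : Atom signature n) σ {x} → ⟪ ![ ‵ l ] atom (inclusion A) ⟫ σ x →
                  x ⊩ ![ l ] atom (subᵃ σ A)
  atom-observed l (p · ts) σ u = observe u λ { x (q , r) →
    !-observed {x = x} q (observe r λ _ → id) }
  tensor-observed l A []       σ u = atom-observed l A σ u
  tensor-observed l A (B ∷ Bs) σ u = observe u λ { _ (y , z , p , q , refl) →
    ⊗-observed {y} {z} {c = ![ l ] subᵃ σ A} {tensor l (subᵃ σ B) (List.map (subᵃ σ) Bs)}
      (atom-observed l A σ p) (tensor-observed l B Bs σ q) }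

  constraint-observed : ∀ (c : Con n) σ {x} → ⟪ ⟦ c ⟧ᶜ ⟫ σ x → x ⊩ ⌊ subᶜ σ c ⌋
  constraint-observed 𝟏          σ u = observe u λ { _ refl → done (⊢₀-pure 𝟏R) }
  constraint-observed (c ⊗ d)    σ u = observe u λ { _ (y , z , p , q , refl) →
    ⊗-observed {y} {z} {subᶜ σ c} {subᶜ σ d}
      (constraint-observed c σ p) (constraint-observed d σ q) }
  constraint-observed (∃ᶜ c)     σ u = observe u λ { _ (t , p) →
    run-entails {c = subᶜ (σ ▸ t) c} (constraint-observed c (σ ▸ t) p)
      (⊢₀-pure (∃R t (subst (Σ₀ ∣ [ ⌊ subᶜ (σ ▸ t) c ⌋ ] ⟶_) (E₀.formula-open σ t c) init))) }
  constraint-observed (![ l ] A) σ u = atom-observed l A σ u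
  constraint-observed (![ l ]⨂ (A ∷ Bs)) σ u = observe u λ { x (q , r) →
    !-observed {x = x} q (subst (x ⊩_) (tensor-formula l (subᵃ σ A) (List.map (subᵃ σ) Bs))
      (tensor-observed l A Bs σ (subst (λ F → ⟪ F ⟫ σ x) (sym (tensor-formulaᴱ l A Bs)) r))) }

  process-holds : ∀ (P : Proc n) ρ → ⟪ ⟦ P ⟧ᴾ ⟫ (var ∘ ρ) (running (renᴾ ρ P))
  -- Additive conjunction asks the same state to satisfy every conjunct, so the full choice `all`
  -- stays fixed while the recursion consumes the branches.
  branches-hold : ∀ (c : Con n) P bs ρ {all} →
                  (∀ {b} → b ∈ (subᶜ (var ∘ ρ) c , renᴾ ρ P) ∷ renᴮ ρ bs → b ∈ toList all) →
                  ⟪ branches c P bs ⟫ (var ∘ ρ) (running (asks all))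
  branch-holds : ∀ (c : Con n) P ρ {all} →
                 (subᶜ (var ∘ ρ) c , renᴾ ρ P) ∈ toList all →
                 ⟪ ⟦ c ⟧ᶜ ⊸ ⟦ P ⟧ᴾ ⟫ (var ∘ ρ) (running (asks all))
  process-holds (tell c) ρ =
    η (_ , fact ⟦ c ⟧ᶜ (var ∘ ρ) λ y o h → tell (h _ (stored-holds c (var ∘ ρ))))
  process-holds (asks ((c , P) ∷ bs)) ρ = η (_ , branches-hold c P bs ρ id)
  process-holds (P ∥ Q) ρ y o h = par (h _ (_ , _ , process-holds P ρ , process-holds Q ρ , refl))
  -- The opened body lies in the denotation at `▸ var (free x)` for every `x`, so the list of
  -- excluded names can be empty.
  process-holds (local P) ρ = η (_ , λ y o h → local [] λ x _ →
    h _ (var (free x) , coincidence ⟦ P ⟧ᴾ (agree (λ v → opened x v))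
      (subst (⟪ ⟦ P ⟧ᴾ ⟫ _) (cong running (sym (renᴾ-fuse (λ _ → refl) P)))
        (process-holds P (openWith x ∘ liftʳ ρ)))))
    where
    open-shift : ∀ x (v : Var 0) → openWith x (shift v) ≡ v
    open-shift x (free y) = refl
    opened : ∀ x v → var (openWith x (liftʳ ρ v)) ≡ ((var ∘ ρ) ▸ var (free x)) v
    opened x (bound zero)    = refl
    opened x (bound (suc i)) = cong var (open-shift x (ρ (bound i)))
    opened x (free y)        = cong var (open-shift x (ρ (free y)))
  process-holds (call p ys) ρ =
    η (_ , η (Vec.map ρ ys , trans (subᵗˢ-map-var (var ∘ ρ) ys) (Vec.map-∘ var ρ ys) , refl))
  branches-hold c P []               ρ f = branch-holds c P ρ (f (here refl))
  branches-hold c P ((c′ , P′) ∷ bs) ρ f =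
    branch-holds c P ρ (f (here refl)) , branches-hold c′ P′ bs ρ (f ∘ there)
  branch-holds c P ρ {all} i x@(Γ , D) p = fact ⟦ P ⟧ᴾ (var ∘ ρ) λ { y@(Γ′ , D′) o h →
    perm (↭-reflexive (sym (List.++-assoc Γ [ asks all ] Γ′)))
      (subst (λ D₁ → Run (Γ ++ asks all ∷ Γ′) D₁ o) (cong (_++ D′) (sym (List.++-identityʳ D)))
        -- The argument state runs until it entails the guard; the cut then adds the guard to the
        -- store, where it triggers the `ask` and is discarded.
        (run-cut (constraint-observed c (var ∘ ρ) p)
          (ask i (entails-more {[ subᶜ (var ∘ ρ) c ]} D′ (⊢₀-pure init))
            (run-discard [ subᶜ (var ∘ ρ) c ] (h _ (process-holds P ρ)))))) }

  ∀⋆-holds : ∀ (F : Form n) {x} →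
             (∀ τ → (∀ z → τ (free z) ≡ var (free z)) → ⟪ F ⟫ τ x) → ⟪ ∀⋆ F ⟫ var x
  ∀⋆-holds {zero}  F h = h var λ _ → refl
  ∀⋆-holds {suc n} F h = ∀⋆-holds (∀ᶠ F) λ τ e t → h (τ ▸ t) e

  axiom-holds : ∀ δ → δ ∈ axioms → ⟪ ![ ‵ ⊤A ] Eᴱ.axiomFormula δ ⟫ var ([] , [])
  axiom-holds δ δ∈ = η ((refl , []) , ∀⋆-holds (⟦ antecedent ⟧ᶜ ⊸ ⟦ consequent ⟧ᶜ) λ τ e x p →
    resp-≈ ⟦ consequent ⟧ᶜ (↭-sym (++-identityʳ _) , ↭-sym (++-identityʳ _))
      (fact ⟦ consequent ⟧ᶜ τ λ y o h →
        run-cut (run-entails {c = subᶜ τ antecedent}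
                   (constraint-observed antecedent τ p) (instance-entails τ e))
                (h _ (stored-holds consequent τ))))
    where
    open Axiom δ
    instance-entails : ∀ τ → (∀ z → τ (free z) ≡ var (free z)) →
                       Entails [ subᶜ τ antecedent ] ⌊ subᶜ τ consequent ⌋
    instance-entails τ e = exch (++-comm [ _ ] ⟦Δ⟧₀)
      (use Δ-structural (∈-map⁺ (λ δ → ![ ⊤A ] E₀.axiomFormula δ) δ∈)
        (dereliction (∀⋆L (⌊ antecedent ⌋ ⊸ ⌊ consequent ⌋) τ e
          (subst₂ (λ F G → Σ₀ ∣ (F ⊸ G) ∷ ⌊ subᶜ τ antecedent ⌋ ∷ ⟦Δ⟧₀ ⟶ ⌊ subᶜ τ consequent ⌋)
            (E₀.formula-sub τ antecedent) (E₀.formula-sub τ consequent)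
            (⊸L {Γ = [ ⌊ subᶜ τ antecedent ⌋ ]} init
              (exch (++-comm ⟦Δ⟧₀ [ _ ]) (⊢₀-pure init)))))))

  -- The quantifiers range over arbitrary terms, but up to closure the antecedent contains only
  -- calls, whose arguments are variables `ys`. Membership thus forces `τ` to map the formal
  -- parameters to `ys`, as unfolding the call does.
  definition-holds : ∀ p → ⟪ ⟦ p ⟧ᴰ ⟫ var ([] , [])
  definition-holds p = η (refl , ∀⋆-holds (callFormula p (formals p) ⊸ ⟦ body p ⟧ᴾ) λ τ e x q →
    bind (fact ⟦ body p ⟧ᴾ τ) q λ { _ (_ , r) → bind (fact ⟦ body p ⟧ᴾ τ) r λ { _ (ys , es , refl) →
      fact ⟦ body p ⟧ᴾ τ λ y o h → call (h _
        (coincidence ⟦ body p ⟧ᴾ (agree (λ { (bound i) → actual ys τ es i ; (free z) → sym (e z) }))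
          (process-holds (body p) (parameters ys)))) } })
    where
    actual : ∀ ys τ → subᵗˢ τ (Vec.map var (formals p)) ≡ Vec.map var ys →
             ∀ i → var (Vec.lookup ys i) ≡ τ (bound i)
    actual ys τ es i = begin
      var (Vec.lookup ys i)                            ≡⟨ Vec.lookup-map i var ys ⟨
      Vec.lookup (Vec.map var ys) i                    ≡⟨ cong (λ us → Vec.lookup us i) es ⟨
      Vec.lookup (subᵗˢ τ (Vec.map var (formals p))) i ≡⟨ cong (λ us → Vec.lookup us i)
                                                               (subᵗˢ-map-var τ (formals p)) ⟩
      Vec.lookup (Vec.map τ (formals p)) i             ≡⟨ Vec.lookup-map i τ (formals p) ⟩
      τ (Vec.lookup (formals p) i)                     ≡⟨ cong τ (Vec.lookup-map i bound (Vec.allFin _)) ⟩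
      τ (bound (Vec.lookup (Vec.allFin (arityᴺ p)) i)) ≡⟨ cong (τ ∘ bound) (Vec.lookup-allFin i) ⟩
      τ (bound i)                                      ∎
      where open ≡-Reasoning

  theory-elements : ∀ Γ {Γ′} → All (λ F → ⟪ F ⟫ var ([] , [])) Γ → (xs : Elements var Γ′) →
                    Σ[ ys ∈ Elements var (Γ ++ Γ′) ] total ys ≡ total xs
  theory-elements []      []       xs = xs , refl
  theory-elements (F ∷ Γ) (p ∷ ps) xs = let ys , e = theory-elements Γ ps xs in (_ , p) ∷ ys , e

  provable⇒run : ∀ P c → Σᴱ ∣ ⟦Δ⟧ ++ ⟦Ψ⟧ ++ [ ⟦ P ⟧ᴾ ] ⟶ ⟦ c ⟧ᶜ ⊗ ⊤ᶠ → Run [ P ] [] ⌊ c ⌋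
  provable⇒run P c d =
    let ys , e  = theory-elements ⟦Ψ⟧ (All.map⁺ (All.tabulate λ {p} _ → definition-holds p))
                    ((running P , holds) ∷ [])
        xs , e′ = theory-elements ⟦Δ⟧ (All.map⁺ (All.tabulate λ {δ} → axiom-holds δ)) ys
    in observe (subst (⟪ ⟦ c ⟧ᶜ ⊗ ⊤ᶠ ⟫ var) (trans e′ e) (sound d var xs))
         λ { _ (y , z , p , _ , refl) →
           -- The state `z` assigned to `⊤` is arbitrary: its processes stay idle and its
           -- constraints are weakened away.
           run-mono (refines-↭ (++-comm (proj₂ z) (proj₂ y)))
             (run-discard (proj₂ z) (run-more (proj₁ z)
               (subst (y ⊩_) (cong ⌊_⌋ (subᶜ-var c)) (constraint-observed c var p)))) }
    where
    holds : ⟪ ⟦ P ⟧ᴾ ⟫ var (running P)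
    holds = subst (λ Q → ⟪ ⟦ P ⟧ᴾ ⟫ var (running Q)) (renᴾ-id (λ _ → refl) P) (process-holds P id)

  -- Executions from runs

  Observable : Config → Con 0 → Set (a ⊔ s)
  Observable C c = ∃[ X ] ∃[ Γ ] Σ[ d ∈ Con 0 ] (C ⟿* ⟨ X ⨾ Γ ⨾ d ⟩) × (hide X d ⊢ c)

  observable-step : ∀ {C D c} → C ⟿ D → Observable D c → Observable C c
  observable-step st (X , Γ , d , sts , h) = X , Γ , d , st ◅ sts , h

  -- Congruence is available only around a transition, so it is merged into the first one; an empty
  -- execution observes just the store, for which the processes are immaterial.
  observable-≋ : ∀ {X Γ Γ′ d c} → Γ ≋ Γ′ → Observable ⟨ X ⨾ Γ′ ⨾ d ⟩ c → Observable ⟨ X ⨾ Γ ⨾ d ⟩ c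
  observable-≋ p (X , _ , d , Star.ε , h) = X , _ , d , Star.ε , h
  observable-≋ {d = d₀} p (X , Γ , d , st ◅ sts , h) =
    X , Γ , d ,
    step-struct (same , p , ⊢-refl {d₀} , ⊢-refl {d₀}) st
                (same , ≋-perm ↭-refl , ⊢-refl , ⊢-refl) ◅ sts ,
    h
    where
    same : ∀ {X : List Name} → X ∼[ set ] X
    same = mk⇔ id id
    ⊢-refl : ∀ {d} → d ⊢ d
    ⊢-refl = ⊢₀-pure init

  hide-⊢ : ∀ X {d c} → Avoids X ⌊ c ⌋ → d ⊢ c → hide X d ⊢ c
  hide-⊢ []      f p = p
  hide-⊢ (x ∷ X) {d} {c} f p =
    exch (++-comm [ _ ] ⟦Δ⟧₀) (∃L x x∉
      (subst (λ F → Σ₀ ∣ F ∷ ⟦Δ⟧₀ ⟶ ⌊ c ⌋) (sym (E₀.formula-reopen x (hide X d)))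
        (exch (++-comm ⟦Δ⟧₀ [ _ ]) (hide-⊢ X {d} {c} (λ (y , z) → f (there y , z)) p))))
    where
    x∉ : x ∉ concatMap fvᶠ (⌊ hide (x ∷ X) d ⌋ ∷ ⌊ c ⌋ ∷ ⟦Δ⟧₀)
    x∉ x∈ with ∈-++⁻ (fvᶠ ⌊ hide (x ∷ X) d ⌋) x∈
    ... | inj₁ q = proj₁ (E₀.formula-abstract-fv x (hide X d) q) refl
    ... | inj₂ q with ∈-++⁻ (fvᶠ ⌊ c ⌋) q
    ... | inj₁ r = f (here refl , r)
    ... | inj₂ r = Δ-closed r

  -- The invariant lets a single constraint `d` stand for the list `D`. Each hidden name is chosen
  -- fresh for the configuration, for the names excluded by the run and for `c`; so `c` avoids all
  -- of `X` at the end, and `hide-⊢` applies.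
  run⇒observable : ∀ {Γ D c d X} → Run Γ D ⌊ c ⌋ → Refines [] [ d ] D → Avoids X ⌊ c ⌋ →
                   Observable ⟨ X ⨾ Γ ⨾ d ⟩ c
  run⇒observable {c = c} {d} {X} (done e) r f =
    X , _ , d , Star.ε , hide-⊢ X {d} {c} f (refines-entails r (λ { (() , _) }) e)
  run⇒observable (perm p e)  r f = observable-≋ (≋-perm (↭-sym p)) (run⇒observable e r f)
  run⇒observable {d = d} (tell {D = D} {c} e) r f =
    observable-step step-tell (run⇒observable e refines f)
    where
    refines : Refines [] [ c ⊗ d ] (c ∷ D)
    refines E xs y e′ = ⊢₀-left {Γ = ⌊ c ⌋ ∷ ⌊ d ⌋ ∷ []} {[ ⌊ c ⊗ d ⌋ ]} ⊗L
      (refines-∷ (λ { (() , _) }) r E xs y e′)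
  run⇒observable (ask i e e′) r f =
    observable-step (step-ask i (refines-entails r (λ { (() , _) }) e)) (run⇒observable e′ r f)
  run⇒observable (par e)     r f = observable-≋ ≋-par (run⇒observable e r f)
  run⇒observable {c = c} {d} {X} (local {Γ} {P = P} L h) r f =
    observable-step (step-local x (fresh∉ xs ∘ ∈-++⁺ˡ))
      (run⇒observable (h x (fresh∉ xs ∘ ∈-++⁺ʳ ys ∘ ∈-++⁺ˡ)) r
        λ { (here refl , q) → fresh∉ xs (∈-++⁺ʳ ys (∈-++⁺ʳ L q)) ; (there p , q) → f (p , q) })
    where
    ys = X ++ fvᶜ d ++ concatMap fvᴾ (local P ∷ Γ)
    xs = ys ++ L ++ fvᶠ ⌊ c ⌋
    x  = fresh xs
  run⇒observable (call e)    r f = observable-step step-call (run⇒observable e r f)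

  adequacy⇐ : ∀ P c → Σᴱ ∣ ⟦Δ⟧ ++ ⟦Ψ⟧ ++ [ ⟦ P ⟧ᴾ ] ⟶ ⟦ c ⟧ᶜ ⊗ ⊤ᶠ → P ⇓ c
  adequacy⇐ P c d = run⇒observable (provable⇒run P c d) (refines-left [] [ 𝟏 ] [] 𝟏L) λ { (() , _) }

theorem2 : ∀ {a s} (𝒞 : SoftConstraintSystem a s) →
    let open SoftConstraintSystem 𝒞 in
    (Ψ : Definitions Carrier signature) →
    let open Semantics 𝒞 Ψ
        open Encoding 𝒞 Ψ in
    (P : Proc 0) (c : Con 0) →
    P ⇓ c ⇔ (Σᴱ ∣ ⟦Δ⟧ ++ ⟦Ψ⟧ ++ [ ⟦ P ⟧ᴾ ] ⟶ ⟦ c ⟧ᶜ ⊗ ⊤ᶠ)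
theorem2 𝒞 Ψ P c = mk⇔ (Adequacy⇒.adequacy⇒ 𝒞 Ψ P c) (Adequacy⇐.adequacy⇐ 𝒞 Ψ P c)
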